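{- Let $d \ge 4$ be an integer. Then there exists an integral convex polytope $\mathcal{P}$ of dimension $d$ with $\mu_{\mathrm{Hilb}}(\mathcal{P}) = d-1$ and $\mu_{\mathrm{midp}}(\mathcal{P}) = \mu_{\mathrm{idp}}(\mathcal{P}) = d-2$.
   Context: An integral convex polytope $\mathcal{P}\subset\mathbb{R}^N$ has all vertices in $\mathbb{Z}^N$. For $k \ge 1$, $k\mathcal{P} = \{k\alpha : \alpha \in \mathcal{P}\}$. An integral polytope $\mathcal{Q}$ has the integer decomposition property (IDP) if for every integer $k \geq 1$ and every $\alpha \in k\mathcal{Q} \cap \mathbb{Z}^N$ there are $\alpha_1,\dots,\alpha_k \in \mathcal{Q}\cap\mathbb{Z}^N$ with $\alpha = \alpha_1+\cdots+\alpha_k$. $\mu_{\mathrm{midp}}(\mathcal{P})$ is the least $k>0$ with $k\mathcal{P}$ having IDP; $\mu_{\mathrm{idp}}(\mathcal{P})$ is the least $k>0$ such that $n\mathcal{P}$ has IDP for all $n \ge k$. Let $\mathcal{C}(\mathcal{P})\subset\mathbb{R}^{N+1}$ be the cone generated by the points $(v,1)$, $v$ a vertex of $\mathcal{P}$; the degree of $(\alpha,n)\in\mathcal{C}(\mathcal{P})\cap\mathbb{Z}^{N+1}$ is $n$. $\mu_{\mathrm{Hilb}}(\mathcal{P})$ is the maximal degree of an element of the unique minimal Hilbert basis of $\mathcal{C}(\mathcal{P})$ (the minimal finite set of integer vectors whose nonnegative integer combinations are exactly $\mathcal{C}(\mathcal{P})\cap\mathbb{Z}^{N+1}$). -}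

module Defs where

open import Data.Nat as ℕ using (ℕ; zero; suc; _≤_; _<_; _∸_)
open import Data.Integer as ℤ using (ℤ; +_)
open import Data.Fin using (Fin; zero; suc)
open import Data.Bool using (Bool; true; false)
open import Data.Product using (Σ; ∃; _×_; _,_; proj₁; proj₂)
open import Relation.Nullary using (¬_)
open import Relation.Binary.PropositionalEquality using (_≡_)
open import Function using (_∘_)

∑ℕ : ∀ {n} → (Fin n → ℕ) → ℕ
∑ℕ {zero}  f = 0
∑ℕ {suc n} f = f zero ℕ.+ ∑ℕ (f ∘ suc)

∑ℤ : ∀ {n} → (Fin n → ℤ) → ℤ
∑ℤ {zero}  f = + 0
∑ℤ {suc n} f = f zero ℤ.+ ∑ℤ (f ∘ suc)

Point : ℕ → Set
Point N = Fin N → ℤ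

-- An integral polytope P = conv(V 0, …, V (n-1)) ⊂ ℝ^N, V i ∈ ℤ^N.
Polytope : ℕ → ℕ → Set
Polytope N n = Fin n → Point N

-- α ∈ kP ∩ ℤ^N : α is a convex combination (rational, nonnegative, weights
-- summing to k) of the V i; clearing denominators: m α = ∑ c_i V_i with
-- c_i ∈ ℕ, ∑ c_i = k m, m ≥ 1.
InDilate : ∀ {N n} → Polytope N n → ℕ → Point N → Set
InDilate {N} {n} V k α =
  Σ ℕ λ m → (1 ≤ m) × Σ (Fin n → ℕ) λ c →
    (∑ℕ c ≡ k ℕ.* m) × (∀ j → (+ m) ℤ.* α j ≡ ∑ℤ (λ i → (+ c i) ℤ.* V i j))

scale : ∀ {N n} → ℕ → Polytope N n → Polytope N n
scale k V i j = (+ k) ℤ.* V i j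

IDP : ∀ {N n} → Polytope N n → Set
IDP {N} V = ∀ k → 1 ≤ k → ∀ (α : Point N) → InDilate V k α →
  Σ (Fin k → Point N) λ β → (∀ i → InDilate V 1 (β i)) ×
    (∀ j → α j ≡ ∑ℤ (λ i → β i j))

MuMidp : ∀ {N n} → Polytope N n → ℕ → Set
MuMidp V m = (1 ≤ m) × IDP (scale m V) ×
  (∀ k → 1 ≤ k → k < m → ¬ IDP (scale k V))

IDPFrom : ∀ {N n} → Polytope N n → ℕ → Set
IDPFrom V k = ∀ n → k ≤ n → IDP (scale n V)

MuIdp : ∀ {N n} → Polytope N n → ℕ → Set
MuIdp V m = (1 ≤ m) × IDPFrom V m × (∀ k → 1 ≤ k → k < m → ¬ IDPFrom V k)

-- points of ℤ^{N+1}, written (α , t); degree is t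
ConePt : ℕ → Set
ConePt N = Point N × ℤ

_≈ᶜ_ : ∀ {N} → ConePt N → ConePt N → Set
x ≈ᶜ y = (∀ j → proj₁ x j ≡ proj₁ y j) × (proj₂ x ≡ proj₂ y)

-- (α,t) ∈ C(P) ∩ ℤ^{N+1}, C(P) = cone over (V i , 1); clearing
-- denominators: m (α,t) = ∑ c_i (V_i , 1), c_i ∈ ℕ, m ≥ 1.
InCone : ∀ {N n} → Polytope N n → ConePt N → Set
InCone {N} {n} V (α , t) =
  Σ ℕ λ m → (1 ≤ m) × Σ (Fin n → ℕ) λ c →
    ((+ m) ℤ.* t ≡ + ∑ℕ c) × (∀ j → (+ m) ℤ.* α j ≡ ∑ℤ (λ i → (+ c i) ℤ.* V i j))

comb : ∀ {N h} → (Fin h → ConePt N) → (Fin h → ℕ) → ConePt N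
comb H a = (λ j → ∑ℤ (λ i → (+ a i) ℤ.* proj₁ (H i) j))
         , ∑ℤ (λ i → (+ a i) ℤ.* proj₂ (H i))

GeneratedBy : ∀ {N h} → (Fin h → ConePt N) → (Fin h → Bool) → ConePt N → Set
GeneratedBy {N} {h} H S x =
  Σ (Fin h → ℕ) λ a → (∀ i → S i ≡ false → a i ≡ 0) × (x ≈ᶜ comb H a)

Generates : ∀ {N n h} → Polytope N n → (Fin h → ConePt N) → (Fin h → Bool) → Set
Generates V H S = ∀ x → InCone V x → GeneratedBy H S x

MinimalHilbertBasis : ∀ {N n h} → Polytope N n → (Fin h → ConePt N) → Set
MinimalHilbertBasis V H =
  (∀ i → InCone V (H i)) × Generates V H (λ _ → true) ×
  (∀ S → Generates V H S → ∀ i → S i ≡ true)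

MuHilb : ∀ {N n} → Polytope N n → ℕ → Set
MuHilb {N} V m = Σ ℕ λ h → Σ (Fin h → ConePt N) λ H →
  MinimalHilbertBasis V H × (Σ (Fin h) λ i → proj₂ (H i) ≡ + m) ×
  (∀ i → proj₂ (H i) ℤ.≤ + m)

-- affine independence of a finite family of integer points
-- (integer coefficients suffice, by clearing denominators)
AffIndep : ∀ {N k} → (Fin k → Point N) → Set
AffIndep {N} {k} W = ∀ (c : Fin k → ℤ) → ∑ℤ c ≡ + 0 →
  (∀ j → ∑ℤ (λ i → c i ℤ.* W i j) ≡ + 0) → ∀ i → c i ≡ + 0

Dim : ∀ {N n} → Polytope N n → ℕ → Set
Dim {N} {n} V d =
  (Σ (Fin (suc d) → Fin n) λ f → AffIndep (V ∘ f)) ×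
  (∀ (f : Fin (suc (suc d)) → Fin n) → ¬ AffIndep (V ∘ f))

{-# OPTIONS --safe #-}
module Submission where

-- Put D = d − 2, e = d − 1, r = d + 1 and write points of ℤ^d as (z, p) with p ∈ ℤ^e.  P is the convex hull of the
-- vertical unit segments over q = (r, 0), q₁ = (0, (1,…,1)) and w_k = (0, e_k), so that in the projection
-- Σ w_k = q₁ + D q is the only affine relation.  A cone point with p = Σ a_k w_k + b₁ q₁ + b₂ q and height z in
-- [r b₂, r b₂ + degree] is a sum of vertices.  Lower heights are reached by exchanging copies of q₁ + D q for Σ w_k
-- (which lowers z by r D) and at most one q₁ + i q, 1 ≤ i < D, for a lattice point (z, (1,…,1)) of degree i + 1 with z < r.
-- The only cone point missed in this way is (d, (1,…,1)) of degree d − 1: its height lies above the heights 0,…,d − 1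
-- of Σ w_k and below r.  Hence the Hilbert basis has maximal degree d − 1, and since every other cone point is a sum of
-- vertices and at most one generator of degree ≤ D, the dilates nP with n ≥ D have IDP.  On the face z = 0 the
-- generator (0, (1,…,1)) of degree D persists after adding multiples of w_k, so kP fails IDP for k < D.

open import Defs
open import Data.Nat using (ℕ; _≤_; _∸_)
open import Data.Product using (Σ; _×_)
open import Data.Nat using (zero; suc; _+_; _*_; _<_; z≤n; s≤s; NonZero; >-nonZero)
open import Data.Nat.DivMod using (_/_; _%_; m≡m%n+[m/n]*n; m%n<n)
import Data.Nat.Properties as ℕₚ
open import Data.Nat.Tactic.RingSolver using (solve-∀)
open import Data.Integer as ℤ using (ℤ; +_; -[1+_])
import Data.Integer.Properties as ℤₚ
import Data.Integer.Tactic.RingSolver as ℤSolver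
open import Data.Fin using (Fin; zero; suc; toℕ; fromℕ<; punchIn; combine; remQuot)
import Data.Fin.Properties as Finₚ
open import Data.Vec.Functional using (insertAt)
open import Data.Vec.Functional.Properties using (insertAt-lookup; insertAt-punchIn)
open import Data.Bool using (Bool; true; false)
open import Data.Product using (∃; _,_; proj₁; proj₂; ∃₂)
open import Data.Sum using (_⊎_; inj₁; inj₂)
open import Data.Empty using (⊥-elim)
open import Data.Sum.Function.Propositional using (_⊎-↔_)
open import Function using (_∘_; _↔_; Inverse)
open import Function.Properties.Inverse using (↔-refl; ↔-trans)
open import Relation.Nullary using (¬_; yes; no; contradiction)
open import Relation.Binary using (tri<; tri≈; tri>)
open import Relation.Binary.PropositionalEquality
import Algebra.Properties.Semiring.Sum ℕₚ.+-*-semiring as ℕSum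
import Algebra.Properties.Semiring.Sum ℤₚ.+-*-semiring as ℤSum
import Algebra.Properties.CommutativeMonoid.Sum ℤₚ.+-0-commutativeMonoid as ℤSum₀

-- Finite sums

∑ℕ≡sum : ∀ {n} (f : Fin n → ℕ) → ∑ℕ f ≡ ℕSum.sum f
∑ℕ≡sum {zero}  f = refl
∑ℕ≡sum {suc n} f = cong (_+_ (f zero)) (∑ℕ≡sum (f ∘ suc))

∑ℤ≡sum : ∀ {n} (f : Fin n → ℤ) → ∑ℤ f ≡ ℤSum.sum f
∑ℤ≡sum {zero}  f = refl
∑ℤ≡sum {suc n} f = cong (ℤ._+_ (f zero)) (∑ℤ≡sum (f ∘ suc))

∑ℕ-cong : ∀ {n} {f g : Fin n → ℕ} → (∀ i → f i ≡ g i) → ∑ℕ f ≡ ∑ℕ g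
∑ℕ-cong {f = f} {g} f≗g =
  trans (∑ℕ≡sum f) (trans (ℕSum.sum-cong-≗ f≗g) (sym (∑ℕ≡sum g)))

∑ℕ-+ : ∀ {n} (f g : Fin n → ℕ) → ∑ℕ (λ i → f i + g i) ≡ ∑ℕ f + ∑ℕ g
∑ℕ-+ f g = trans (∑ℕ≡sum (λ i → f i + g i))
  (trans (ℕSum.∑-distrib-+ f g) (sym (cong₂ _+_ (∑ℕ≡sum f) (∑ℕ≡sum g))))

∑ℕ-*ˡ : ∀ {n} m (f : Fin n → ℕ) → m * ∑ℕ f ≡ ∑ℕ (λ i → m * f i)
∑ℕ-*ˡ m f = trans (cong (m *_) (∑ℕ≡sum f))
  (trans (ℕSum.*-distribˡ-sum m f) (sym (∑ℕ≡sum (λ i → m * f i))))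

∑ℕ-*ʳ : ∀ {n} m (f : Fin n → ℕ) → ∑ℕ f * m ≡ ∑ℕ (λ i → f i * m)
∑ℕ-*ʳ m f = trans (cong (_* m) (∑ℕ≡sum f))
  (trans (ℕSum.*-distribʳ-sum m f) (sym (∑ℕ≡sum (λ i → f i * m))))

∑ℕ-swap : ∀ {m n} (f : Fin m → Fin n → ℕ) →
  ∑ℕ (λ i → ∑ℕ (f i)) ≡ ∑ℕ (λ j → ∑ℕ (λ i → f i j))
∑ℕ-swap f = trans (∑ℕ-cong (λ i → ∑ℕ≡sum (f i))) (trans (∑ℕ≡sum (λ i → ℕSum.sum (f i)))
  (trans (ℕSum.∑-comm f) (trans (sym (∑ℕ≡sum (λ j → ℕSum.sum (λ i → f i j))))
    (∑ℕ-cong (λ j → sym (∑ℕ≡sum (λ i → f i j)))))))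

∑ℕ-const : ∀ {n} {f : Fin n → ℕ} c → (∀ i → f i ≡ c) → ∑ℕ f ≡ n * c
∑ℕ-const {zero}  c f≡c = refl
∑ℕ-const {suc n} c f≡c = cong₂ _+_ (f≡c zero) (∑ℕ-const c (f≡c ∘ suc))

∑ℕ-mono : ∀ {n} {f g : Fin n → ℕ} → (∀ i → f i ≤ g i) → ∑ℕ f ≤ ∑ℕ g
∑ℕ-mono {zero}  f≤g = z≤n
∑ℕ-mono {suc n} f≤g = ℕₚ.+-mono-≤ (f≤g zero) (∑ℕ-mono (f≤g ∘ suc))

∑ℕ≡0⇒≡0 : ∀ {n} (f : Fin n → ℕ) → ∑ℕ f ≡ 0 → ∀ i → f i ≡ 0
∑ℕ≡0⇒≡0 f eq zero    = ℕₚ.m+n≡0⇒m≡0 (f zero) eq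
∑ℕ≡0⇒≡0 f eq (suc i) = ∑ℕ≡0⇒≡0 (f ∘ suc) (ℕₚ.m+n≡0⇒n≡0 (f zero) eq) i

∑ℕ-nonzero-term : ∀ {n} (f : Fin n → ℕ) {s} → ∑ℕ f ≡ suc s → ∃₂ λ i x → f i ≡ suc x
∑ℕ-nonzero-term {suc n} f eq with f zero in f0≡
... | suc x = zero , x , f0≡
... | zero with ∑ℕ-nonzero-term (f ∘ suc) eq
...   | i , x , fi≡ = suc i , x , fi≡

∑ℕ-pos : ∀ {n} (f : Fin n → ℕ) → ∑ℤ (λ i → + f i) ≡ + ∑ℕ f
∑ℕ-pos {zero}  f = refl
∑ℕ-pos {suc n} f = cong (ℤ._+_ (+ f zero)) (∑ℕ-pos (f ∘ suc))

∑ℤ-cong : ∀ {n} {f g : Fin n → ℤ} → (∀ i → f i ≡ g i) → ∑ℤ f ≡ ∑ℤ g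
∑ℤ-cong {f = f} {g} f≗g =
  trans (∑ℤ≡sum f) (trans (ℤSum.sum-cong-≗ f≗g) (sym (∑ℤ≡sum g)))

∑ℤ-+ : ∀ {n} (f g : Fin n → ℤ) → ∑ℤ (λ i → f i ℤ.+ g i) ≡ ∑ℤ f ℤ.+ ∑ℤ g
∑ℤ-+ f g = trans (∑ℤ≡sum (λ i → f i ℤ.+ g i))
  (trans (ℤSum.∑-distrib-+ f g) (sym (cong₂ ℤ._+_ (∑ℤ≡sum f) (∑ℤ≡sum g))))

∑ℤ-*ˡ : ∀ {n} m (f : Fin n → ℤ) → m ℤ.* ∑ℤ f ≡ ∑ℤ (λ i → m ℤ.* f i)
∑ℤ-*ˡ m f = trans (cong (ℤ._*_ m) (∑ℤ≡sum f))
  (trans (ℤSum.*-distribˡ-sum m f) (sym (∑ℤ≡sum (λ i → m ℤ.* f i))))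

∑ℤ-zero : ∀ {n} {f : Fin n → ℤ} → (∀ i → f i ≡ + 0) → ∑ℤ f ≡ + 0
∑ℤ-zero {zero}  f≡0 = refl
∑ℤ-zero {suc n} f≡0 = cong₂ ℤ._+_ (f≡0 zero) (∑ℤ-zero (f≡0 ∘ suc))

∑ℤ-punchIn : ∀ {n} i (f : Fin (suc n) → ℤ) → ∑ℤ f ≡ f i ℤ.+ ∑ℤ (f ∘ punchIn i)
∑ℤ-punchIn i f = trans (∑ℤ≡sum f) (trans (ℤSum₀.sum-remove {i = i} f)
  (cong (ℤ._+_ (f i)) (sym (∑ℤ≡sum (f ∘ punchIn i)))))

δ : ∀ {n} → Fin n → Fin n → ℕ
δ zero    zero    = 1
δ zero    (suc j) = 0
δ (suc i) zero    = 0
δ (suc i) (suc j) = δ i j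

δ-refl : ∀ {n} (i : Fin n) → δ i i ≡ 1
δ-refl zero    = refl
δ-refl (suc i) = δ-refl i

δ≡suc⇒≡ : ∀ {n x} (i j : Fin n) → δ i j ≡ suc x → i ≡ j
δ≡suc⇒≡ zero    zero    eq = refl
δ≡suc⇒≡ (suc i) (suc j) eq = cong suc (δ≡suc⇒≡ i j eq)

δ-comm : ∀ {n} (i j : Fin n) → δ i j ≡ δ j i
δ-comm zero    zero    = refl
δ-comm zero    (suc j) = refl
δ-comm (suc i) zero    = refl
δ-comm (suc i) (suc j) = δ-comm i j

∑ℕ-δ : ∀ {n} (k : Fin n) (f : Fin n → ℕ) → ∑ℕ (λ i → δ k i * f i) ≡ f k
∑ℕ-δ {suc n} zero f =
  trans (cong₂ _+_ (ℕₚ.*-identityˡ (f zero)) (trans (∑ℕ-const {n} 0 (λ _ → refl)) (ℕₚ.*-zeroʳ n)))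
    (ℕₚ.+-identityʳ (f zero))
∑ℕ-δ (suc k) f = ∑ℕ-δ k (f ∘ suc)

∑ℤ-δ : ∀ {n} (k : Fin n) (f : Fin n → ℤ) → ∑ℤ (λ i → f i ℤ.* + δ i k) ≡ f k
∑ℤ-δ {suc n} zero f =
  trans (cong₂ ℤ._+_ (ℤₚ.*-identityʳ (f zero)) (∑ℤ-zero (λ i → ℤₚ.*-zeroʳ (f (suc i)))))
    (ℤₚ.+-identityʳ (f zero))
∑ℤ-δ {suc n} (suc k) f =
  trans (cong₂ ℤ._+_ (ℤₚ.*-zeroʳ (f zero)) (∑ℤ-δ k (f ∘ suc))) (ℤₚ.+-identityˡ (f (suc k)))

∑ℕ-δ₁ : ∀ {n} (k : Fin n) → ∑ℕ (δ k) ≡ 1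
∑ℕ-δ₁ k = trans (∑ℕ-cong (λ i → sym (ℕₚ.*-identityʳ (δ k i)))) (∑ℕ-δ k (λ _ → 1))

-- One copy of the index `l` is taken out of the weights. The truncated subtraction is exact,
-- because `δ l` is bounded by `c` once `c l` is positive.
∑ℕ-δ+rest : ∀ {n} (c f : Fin n → ℕ) l {x} → c l ≡ suc x →
  ∑ℕ (λ i → c i * f i) ≡ f l + ∑ℕ (λ i → (c i ∸ δ l i) * f i)
∑ℕ-δ+rest c f l {x} cl≡ =
  trans (∑ℕ-cong (λ i → trans (cong (_* f i) (sym (ℕₚ.m+[n∸m]≡n (δ≤c i))))
      (ℕₚ.*-distribʳ-+ (f i) (δ l i) (c i ∸ δ l i))))
    (trans (∑ℕ-+ (λ i → δ l i * f i) (λ i → (c i ∸ δ l i) * f i))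
      (cong (_+ ∑ℕ (λ i → (c i ∸ δ l i) * f i)) (∑ℕ-δ l f)))
  where
  δ≤c : ∀ i → δ l i ≤ c i
  δ≤c i with δ l i in eq
  ... | zero  = z≤n
  ... | suc y with δ≡suc⇒≡ l i eq
  ...   | refl = ℕₚ.≤-trans (ℕₚ.≤-reflexive (trans (sym eq) (δ-refl l))) (subst (1 ≤_) (sym cl≡) (s≤s z≤n))

-- m + 1 integer vectors in ℤ^m are linearly dependent, by fraction-free elimination of the first coordinate.
linearly-dependent : ∀ m (A : Fin (suc m) → Fin m → ℤ) → Σ (Fin (suc m) → ℤ) λ c →
  (∃ λ i → c i ≢ + 0) × (∀ j → ∑ℤ (λ i → c i ℤ.* A i j) ≡ + 0)
linearly-dependent zero A = (λ _ → + 1) , (zero , λ ()) , λ ()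
linearly-dependent (suc m) A with Finₚ.all? (λ i → A i zero ℤₚ.≟ + 0)
... | yes A₀≡0 with linearly-dependent m (λ i j → A (suc i) (suc j))
...   | c , (i , ci≢0) , c-dep = c′ , (suc i , ci≢0) , c′-dep
  where
  c′ : Fin (suc (suc m)) → ℤ
  c′ zero    = + 0
  c′ (suc i) = c i
  c′-dep : ∀ j → ∑ℤ (λ i → c′ i ℤ.* A i j) ≡ + 0
  c′-dep zero    = ∑ℤ-zero (λ i → trans (cong (ℤ._*_ (c′ i)) (A₀≡0 i)) (ℤₚ.*-zeroʳ (c′ i)))
  c′-dep (suc j) = trans (cong₂ ℤ._+_ (ℤₚ.*-zeroˡ (A zero (suc j))) (c-dep j)) refl
linearly-dependent (suc m) A | no ¬A₀≡0 with Finₚ.¬∀⟶∃¬ _ _ (λ i → A i zero ℤₚ.≟ + 0) ¬A₀≡0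
... | p , π≢0 = c′ , (punchIn p i₀ , c′i₀≢0) , c′-dep
  where
  π : ℤ
  π = A p zero
  row : Fin (suc m) → Fin (suc m) → ℤ
  row i j = π ℤ.* A (punchIn p i) j ℤ.- A (punchIn p i) zero ℤ.* A p j
  IH = linearly-dependent m (λ i j → row i (suc j))
  c : Fin (suc m) → ℤ
  c = proj₁ IH
  i₀ : Fin (suc m)
  i₀ = proj₁ (proj₁ (proj₂ IH))
  first : Fin (suc m) → ℤ
  first i = c i ℤ.* A (punchIn p i) zero
  πc : Fin (suc m) → ℤ
  πc i = π ℤ.* c i
  -- The pivot coefficient cancels the first coordinate. The others carry the factor `π`, so no
  -- division occurs and a nonzero coefficient stays nonzero.
  c′ : Fin (suc (suc m)) → ℤ
  c′ = insertAt πc p (ℤ.- ∑ℤ first)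
  c′i₀≢0 : c′ (punchIn p i₀) ≢ + 0
  c′i₀≢0 eq with ℤₚ.i*j≡0⇒i≡0∨j≡0 π (trans (sym (insertAt-punchIn πc p (ℤ.- ∑ℤ first) i₀)) eq)
  ... | inj₁ π≡0 = π≢0 π≡0
  ... | inj₂ ci₀≡0 = proj₂ (proj₁ (proj₂ IH)) ci₀≡0
  row-dep : ∀ j → ∑ℤ (λ i → c i ℤ.* row i j) ≡ + 0
  row-dep zero = ∑ℤ-zero (λ i → trans (cong (ℤ._*_ (c i)) (lem π (A (punchIn p i) zero))) (ℤₚ.*-zeroʳ (c i)))
    where
    lem : ∀ x y → x ℤ.* y ℤ.- y ℤ.* x ≡ + 0
    lem = ℤSolver.solve-∀
  row-dep (suc j) = proj₂ (proj₂ IH) j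
  open ≡-Reasoning
  regroup : ∀ x y u v w → x ℤ.* y ℤ.* u ≡ (v ℤ.* (y ℤ.* w)) ℤ.+ y ℤ.* (x ℤ.* u ℤ.- w ℤ.* v)
  regroup = ℤSolver.solve-∀
  cancel : ∀ s a t → ℤ.- s ℤ.* a ℤ.+ (a ℤ.* s ℤ.+ t) ≡ t
  cancel = ℤSolver.solve-∀
  c′-dep : ∀ j → ∑ℤ (λ i → c′ i ℤ.* A i j) ≡ + 0
  c′-dep j = begin
    ∑ℤ (λ i → c′ i ℤ.* A i j)
      ≡⟨ ∑ℤ-punchIn p (λ i → c′ i ℤ.* A i j) ⟩
    c′ p ℤ.* A p j ℤ.+ ∑ℤ (λ i → c′ (punchIn p i) ℤ.* A (punchIn p i) j)
      ≡⟨ cong₂ ℤ._+_ (cong (ℤ._* A p j) (insertAt-lookup πc p (ℤ.- ∑ℤ first)))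
           (∑ℤ-cong (λ i → trans (cong (ℤ._* A (punchIn p i) j) (insertAt-punchIn πc p (ℤ.- ∑ℤ first) i))
             (regroup π (c i) (A (punchIn p i) j) (A p j) (A (punchIn p i) zero)))) ⟩
    ℤ.- ∑ℤ first ℤ.* A p j ℤ.+ ∑ℤ (λ i → A p j ℤ.* first i ℤ.+ c i ℤ.* row i j)
      ≡⟨ cong (ℤ._+_ (ℤ.- ∑ℤ first ℤ.* A p j))
           (trans (∑ℤ-+ (λ i → A p j ℤ.* first i) (λ i → c i ℤ.* row i j))
             (cong (ℤ._+ ∑ℤ (λ i → c i ℤ.* row i j)) (sym (∑ℤ-*ˡ (A p j) first)))) ⟩
    ℤ.- ∑ℤ first ℤ.* A p j ℤ.+ (A p j ℤ.* ∑ℤ first ℤ.+ ∑ℤ (λ i → c i ℤ.* row i j))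
      ≡⟨ cancel (∑ℤ first) (A p j) _ ⟩
    ∑ℤ (λ i → c i ℤ.* row i j)
      ≡⟨ row-dep j ⟩
    + 0 ∎

-- Dilates of polytopes with nonnegative vertices

ℕPoint : ℕ → Set
ℕPoint N = Fin N → ℕ

embed : ∀ {N n} → (Fin n → ℕPoint N) → Polytope N n
embed V i j = + V i j

-- Vertices with natural coordinates force natural coordinates on every lattice point of a dilate,
-- so membership can be treated without integers.
record Dilate {N n} (V : Fin n → ℕPoint N) (k : ℕ) (α : ℕPoint N) : Set where
  constructor dilate
  field
    m   : ℕ
    1≤m : 1 ≤ m
    c   : Fin n → ℕ
    ∑c  : ∑ℕ c ≡ k * m
    m*α : ∀ j → m * α j ≡ ∑ℕ (λ i → c i * V i j)

∑-pos-* : ∀ {n} (c f : Fin n → ℕ) → ∑ℤ (λ i → + c i ℤ.* + f i) ≡ + ∑ℕ (λ i → c i * f i)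
∑-pos-* c f = trans (∑ℤ-cong (λ i → sym (ℤₚ.pos-* (c i) (f i)))) (∑ℕ-pos (λ i → c i * f i))

pos-quotient : ∀ {m s} x → 1 ≤ m → + m ℤ.* x ≡ + s → ∃ λ y → x ≡ + y × m * y ≡ s
pos-quotient {m} (+ y) 1≤m eq = y , refl , ℤₚ.+-injective (trans (ℤₚ.pos-* m y) eq)
pos-quotient {suc m} -[1+ y ] 1≤m ()

Dilate⇒InDilate : ∀ {N n k} {V : Fin n → ℕPoint N} {α} →
  Dilate V k α → InDilate (embed V) k (λ j → + α j)
Dilate⇒InDilate {V = V} {α} (dilate m 1≤m c ∑c eq) = m , 1≤m , c , ∑c , λ j →
  trans (sym (ℤₚ.pos-* m (α j)))
    (trans (cong +_ (eq j)) (sym (∑-pos-* c (λ i → V i j))))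

InDilate⇒Dilate : ∀ {N n} (V : Fin n → ℕPoint N) k {α} →
  InDilate (embed V) k α → Σ (ℕPoint N) λ α′ → (∀ j → α j ≡ + α′ j) × Dilate V k α′
InDilate⇒Dilate V k {α} (m , 1≤m , c , ∑c , eq) =
  (λ j → proj₁ (q j)) , (λ j → proj₁ (proj₂ (q j))) ,
  dilate m 1≤m c ∑c (λ j → proj₂ (proj₂ (q j)))
  where
  q = λ j → pos-quotient (α j) 1≤m (trans (eq j) (∑-pos-* c (λ i → V i j)))

Dilate⇒InCone : ∀ {N n k} {V : Fin n → ℕPoint N} {α} →
  Dilate V k α → InCone (embed V) ((λ j → + α j) , + k)
Dilate⇒InCone {k = k} d with Dilate⇒InDilate d
... | m , 1≤m , c , ∑c , eq = m , 1≤m , c ,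
  trans (sym (ℤₚ.pos-* m k)) (cong +_ (trans (ℕₚ.*-comm m k) (sym ∑c))) , eq

InCone⇒Dilate : ∀ {N n} {V : Fin n → ℕPoint N} {α t} → InCone (embed V) (α , t) →
  Σ (ℕPoint N) λ α′ → Σ ℕ λ k → (∀ j → α j ≡ + α′ j) × t ≡ + k × Dilate V k α′
InCone⇒Dilate {V = V} {t = t} (m , 1≤m , c , ∑c , eq) with pos-quotient t 1≤m ∑c
... | k , t≡k , mk≡∑c
  with InDilate⇒Dilate V k (m , 1≤m , c , trans (sym mk≡∑c) (ℕₚ.*-comm m k) , eq)
...   | α′ , α≡α′ , d = α′ , k , α≡α′ , t≡k , d

-- The factor `s` moves from the vertices into the weights; in the converse `InDilate-scale` it
-- moves into the denominator.
InDilate-unscale : ∀ {N n} {V : Polytope N n} s k {α} →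
  InDilate (scale s V) k α → InDilate V (k * s) α
InDilate-unscale {V = V} s k (m , 1≤m , c , ∑c , eq) =
  m , 1≤m , (λ i → c i * s) ,
  trans (sym (∑ℕ-*ʳ s c)) (trans (cong (_* s) ∑c) (swap k m s)) ,
  λ j → trans (eq j) (∑ℤ-cong (λ i → trans (sym (ℤₚ.*-assoc (+ c i) (+ s) (V i j)))
    (cong (ℤ._* V i j) (sym (ℤₚ.pos-* (c i) s)))))
  where
  swap : ∀ k m s → k * m * s ≡ k * s * m
  swap = solve-∀

InDilate-scale : ∀ {N n} {V : Polytope N n} s k {α} → 1 ≤ s →
  InDilate V (k * s) α → InDilate (scale s V) k α
InDilate-scale {V = V} s k {α} 1≤s (m , 1≤m , c , ∑c , eq) =
  s * m , ℕₚ.*-mono-≤ 1≤s 1≤m , c , trans ∑c (ℕₚ.*-assoc k s m) , λ j →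
    trans (cong (ℤ._* α j) (ℤₚ.pos-* s m)) (trans (ℤₚ.*-assoc (+ s) (+ m) (α j))
      (trans (cong (ℤ._*_ (+ s)) (eq j)) (trans (∑ℤ-*ˡ (+ s) (λ i → + c i ℤ.* V i j))
        (∑ℤ-cong (λ i → swap (+ s) (+ c i) (V i j))))))
  where
  swap : ∀ x y z → x ℤ.* (y ℤ.* z) ≡ y ℤ.* (x ℤ.* z)
  swap = ℤSolver.solve-∀

Splits : ∀ {N n} → (Fin n → ℕPoint N) → ℕ → ℕ → ℕPoint N → Set
Splits {N} V s k α = Σ (Fin k → ℕPoint N) λ β →
  (∀ i → Dilate V s (β i)) × (∀ j → α j ≡ ∑ℕ (λ i → β i j))

-- A single summand needs no splitting, so only two or more are treated. In the construction below
-- this keeps the exceptional cone point of degree `D + 1` harmless: for `s ≥ D ≥ 2` that degree is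
-- smaller than `2 * s`.
splits⇒IDP : ∀ {N n} {V : Fin n → ℕPoint N} s → 1 ≤ s →
  (∀ k α → Dilate V (suc (suc k) * s) α → Splits V s (suc (suc k)) α) →
  IDP (scale s (embed V))
splits⇒IDP s 1≤s split (suc zero) 1≤k α α∈ =
  (λ _ → α) , (λ _ → α∈) , λ j → sym (ℤₚ.+-identityʳ (α j))
splits⇒IDP {V = V} s 1≤s split (suc (suc k)) 1≤k α α∈
  with InDilate⇒Dilate V (suc (suc k) * s) (InDilate-unscale s (suc (suc k)) α∈)
... | α′ , α≡α′ , α′∈ with split k α′ α′∈
...   | β , β∈ , α′≡∑β = (λ i j → + β i j) ,
  (λ i → InDilate-scale s 1 1≤s
    (Dilate⇒InDilate (subst (λ k → Dilate _ k (β i)) (sym (ℕₚ.*-identityˡ s)) (β∈ i)))) ,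
  λ j → trans (α≡α′ j) (trans (cong +_ (α′≡∑β j)) (sym (∑ℕ-pos (λ i → β i j))))

IDP⇒splits : ∀ {N n} {V : Fin n → ℕPoint N} s → 1 ≤ s → IDP (scale s (embed V)) →
  ∀ k α → 1 ≤ k → Dilate V (k * s) α → Splits V s k α
IDP⇒splits {V = V} s 1≤s idp k α 1≤k α∈
  with idp k 1≤k (λ j → + α j) (InDilate-scale s k 1≤s (Dilate⇒InDilate α∈))
... | β , β∈ , α≡∑β = (λ i → proj₁ (q i)) ,
  (λ i → subst (λ k → Dilate V k (proj₁ (q i))) (ℕₚ.*-identityˡ s) (proj₂ (proj₂ (q i)))) ,
  λ j → ℤₚ.+-injective (trans (α≡∑β j)
    (trans (∑ℤ-cong (λ i → proj₁ (proj₂ (q i)) j)) (∑ℕ-pos (λ i → proj₁ (q i) j))))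
  where
  q = λ i → InDilate⇒Dilate V (1 * s) (InDilate-unscale s 1 (β∈ i))

Dilate-resp : ∀ {N n k k′} {V : Fin n → ℕPoint N} {α α′} →
  k ≡ k′ → (∀ j → α j ≡ α′ j) → Dilate V k α → Dilate V k′ α′
Dilate-resp refl α≗α′ (dilate m 1≤m c ∑c eq) =
  dilate m 1≤m c ∑c (λ j → trans (cong (m *_) (sym (α≗α′ j))) (eq j))

Dilate-zero : ∀ {N n} {V : Fin n → ℕPoint N} → Dilate V 0 (λ _ → 0)
Dilate-zero {n = n} = dilate 1 (s≤s z≤n) (λ _ → 0)
  (trans (∑ℕ-const {n} 0 (λ _ → refl)) (ℕₚ.*-zeroʳ n))
  (λ j → sym (trans (∑ℕ-const {n} 0 (λ _ → refl)) (ℕₚ.*-zeroʳ n)))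

Dilate-vertex : ∀ {N n} {V : Fin n → ℕPoint N} i → Dilate V 1 (V i)
Dilate-vertex {V = V} i = dilate 1 (s≤s z≤n) (δ i) (∑ℕ-δ₁ i)
  (λ j → trans (ℕₚ.*-identityˡ (V i j)) (sym (∑ℕ-δ i (λ i → V i j))))

Dilate-+ : ∀ {N n k l} {V : Fin n → ℕPoint N} {α β} →
  Dilate V k α → Dilate V l β → Dilate V (k + l) (λ j → α j + β j)
Dilate-+ {k = k} {l} {V} {α} {β} (dilate m 1≤m c ∑c c-eq) (dilate n 1≤n d ∑d d-eq) =
  dilate (m * n) (ℕₚ.*-mono-≤ 1≤m 1≤n) (λ i → n * c i + m * d i)
  (trans (∑ℕ-+ (λ i → n * c i) (λ i → m * d i))
    (trans (cong₂ _+_ (trans (sym (∑ℕ-*ˡ n c)) (cong (n *_) ∑c)) (trans (sym (∑ℕ-*ˡ m d)) (cong (m *_) ∑d)))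
      (degrees k l m n)))
  (λ j → sym (trans (∑ℕ-cong (λ i → expand n (c i) m (d i) (V i j)))
    (trans (∑ℕ-+ (λ i → n * (c i * V i j)) (λ i → m * (d i * V i j)))
      (trans (cong₂ _+_ (trans (sym (∑ℕ-*ˡ n (λ i → c i * V i j))) (cong (n *_) (sym (c-eq j))))
                        (trans (sym (∑ℕ-*ˡ m (λ i → d i * V i j))) (cong (m *_) (sym (d-eq j)))))
        (collect m n (α j) (β j))))))
  where
  degrees : ∀ k l m n → n * (k * m) + m * (l * n) ≡ (k + l) * (m * n)
  degrees = solve-∀
  expand : ∀ n c m d v → (n * c + m * d) * v ≡ n * (c * v) + m * (d * v)
  expand = solve-∀
  collect : ∀ m n a b → n * (m * a) + m * (n * b) ≡ m * n * (a + b)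
  collect = solve-∀

Dilate-÷ : ∀ {N n k} {V : Fin n → ℕPoint N} {α} m → 1 ≤ m →
  Dilate V (m * k) (λ j → m * α j) → Dilate V k α
Dilate-÷ {k = k} {α = α} m 1≤m (dilate n 1≤n c ∑c eq) =
  dilate (n * m) (ℕₚ.*-mono-≤ 1≤n 1≤m) c (trans ∑c (swap m k n))
  (λ j → trans (ℕₚ.*-assoc n m (α j)) (eq j))
  where
  swap : ∀ m k n → m * k * n ≡ k * (n * m)
  swap = solve-∀

-- Linear inequalities on dilates

-- Linear forms in the coordinates and the degree, kept as syntax so that one induction carries
-- every inequality from the vertices to all dilates.
data Linear (N : ℕ) : Set where
  coord  : Fin N → Linear N
  degree : Linear N
  _⊕_    : Linear N → Linear N → Linear N
  _⊙_    : ℕ → Linear N → Linear N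
  total  : ∀ {l} → (Fin l → Linear N) → Linear N

infixl 6 _⊕_
infixr 7 _⊙_

eval : ∀ {N} → Linear N → ℕPoint N → ℕ → ℕ
eval (coord j) α k = α j
eval degree    α k = k
eval (f ⊕ g)   α k = eval f α k + eval g α k
eval (a ⊙ f)   α k = a * eval f α k
eval (total f) α k = ∑ℕ (λ i → eval (f i) α k)

module _ {N n k} {V : Fin n → ℕPoint N} {α} (α∈kP : Dilate V k α) where

  private
    open Dilate α∈kP
    *-swap : ∀ x y z → x * (y * z) ≡ y * (x * z)
    *-swap = solve-∀

  eval-combination : ∀ f → m * eval f α k ≡ ∑ℕ (λ i → c i * eval f (V i) 1)
  eval-combination (coord j) = m*α j
  eval-combination degree =
    trans (ℕₚ.*-comm m k) (trans (sym ∑c) (∑ℕ-cong (λ i → sym (ℕₚ.*-identityʳ (c i)))))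
  eval-combination (f ⊕ g) =
    trans (ℕₚ.*-distribˡ-+ m (eval f α k) (eval g α k))
      (trans (cong₂ _+_ (eval-combination f) (eval-combination g))
        (trans (sym (∑ℕ-+ (λ i → c i * eval f (V i) 1) (λ i → c i * eval g (V i) 1)))
          (∑ℕ-cong (λ i → sym (ℕₚ.*-distribˡ-+ (c i) (eval f (V i) 1) (eval g (V i) 1))))))
  eval-combination (a ⊙ f) =
    trans (*-swap m a (eval f α k)) (trans (cong (a *_) (eval-combination f))
      (trans (∑ℕ-*ˡ a (λ i → c i * eval f (V i) 1))
        (∑ℕ-cong (λ i → *-swap a (c i) (eval f (V i) 1)))))
  eval-combination (total f) =
    trans (∑ℕ-*ˡ m (λ l → eval (f l) α k))
      (trans (∑ℕ-cong (λ l → eval-combination (f l)))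
        (trans (∑ℕ-swap (λ l i → c i * eval (f l) (V i) 1))
          (∑ℕ-cong (λ i → sym (∑ℕ-*ˡ (c i) (λ l → eval (f l) (V i) 1))))))

  -- With denominators cleared, both sides become the same nonnegative combination of their values
  -- at the vertices; the positive denominator then cancels.
  Dilate-≤ : ∀ f g → (∀ i → eval f (V i) 1 ≤ eval g (V i) 1) → eval f α k ≤ eval g α k
  Dilate-≤ f g f≤g = ℕₚ.*-cancelˡ-≤ m {{>-nonZero 1≤m}} (subst₂ _≤_
    (sym (eval-combination f)) (sym (eval-combination g))
    (∑ℕ-mono (λ i → ℕₚ.*-monoʳ-≤ (c i) (f≤g i))))

-- Sums of members of a family

-- The index type is arbitrary because the same notion serves for vertices, lower endpoints and
-- Hilbert basis elements. The equations are pointwise to avoid function extensionality.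
data Units {N} {A : Set} (V : A → ℕPoint N) : ℕ → ℕPoint N → Set where
  none : ∀ {α} → (∀ j → α j ≡ 0) → Units V 0 α
  one  : ∀ {t α β} v → Units V t β → (∀ j → α j ≡ V v j + β j) → Units V (suc t) α

Units-resp : ∀ {N A t t′} {V : A → ℕPoint N} {α α′} →
  t ≡ t′ → (∀ j → α j ≡ α′ j) → Units V t α → Units V t′ α′
Units-resp refl α≗α′ (none α≗0) = none (λ j → trans (sym (α≗α′ j)) (α≗0 j))
Units-resp refl α≗α′ (one v u eq) = one v u (λ j → trans (sym (α≗α′ j)) (eq j))

Units-+ : ∀ {N A s t} {V : A → ℕPoint N} {α β} →
  Units V s α → Units V t β → Units V (s + t) (λ j → α j + β j)
Units-+ {β = β} (none α≗0) u = Units-resp refl (λ j → cong (_+ β j) (sym (α≗0 j))) u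
Units-+ {V = V} {β = β} (one {β = α} v w eq) u = one v (Units-+ w u)
  (λ j → trans (cong (_+ β j) (eq j)) (ℕₚ.+-assoc (V v j) (α j) (β j)))

Units-multiple : ∀ {N A} {V : A → ℕPoint N} t v → Units V t (λ j → t * V v j)
Units-multiple zero    v = none (λ _ → refl)
Units-multiple (suc t) v = one v (Units-multiple t v) (λ _ → refl)

Units-combination : ∀ {N n A} {V : A → ℕPoint N} (v : Fin n → A) c →
  Units V (∑ℕ c) (λ j → ∑ℕ (λ i → c i * V (v i) j))
Units-combination {n = zero}  v c = none (λ _ → refl)
Units-combination {n = suc n} v c =
  Units-+ (Units-multiple (c zero) (v zero)) (Units-combination (v ∘ suc) (c ∘ suc))

Units-split : ∀ {N A} {V : A → ℕPoint N} s {t α} → Units V (s + t) α →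
  ∃₂ λ β γ → Units V s β × Units V t γ × (∀ j → α j ≡ β j + γ j)
Units-split zero {α = α} u = (λ _ → 0) , α , none (λ _ → refl) , u , λ _ → refl
Units-split {V = V} (suc s) (one v u eq) with Units-split s u
... | β , γ , b , c , eq′ = (λ j → V v j + β j) , γ , one v b (λ _ → refl) , c ,
  λ j → trans (eq j) (trans (cong (_+_ (V v j)) (eq′ j)) (sym (ℕₚ.+-assoc (V v j) (β j) (γ j))))

Units-weights : ∀ {N n t} {V : Fin n → ℕPoint N} {α} → Units V t α →
  Σ (Fin n → ℕ) λ c → ∀ j → α j ≡ ∑ℕ (λ i → c i * V i j)
Units-weights {n = n} (none α≗0) = (λ _ → 0) ,
  λ j → trans (α≗0 j) (sym (trans (∑ℕ-const {n} 0 (λ _ → refl)) (ℕₚ.*-zeroʳ n)))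
Units-weights {V = V} (one {β = β} v u eq) with Units-weights u
... | c , c-eq = (λ i → δ v i + c i) , λ j →
  trans (eq j) (sym (trans (∑ℕ-cong (λ i → ℕₚ.*-distribʳ-+ (V i j) (δ v i) (c i)))
    (trans (∑ℕ-+ (λ i → δ v i * V i j) (λ i → c i * V i j))
      (cong₂ _+_ (∑ℕ-δ v (λ i → V i j)) (sym (c-eq j))))))

Units⇒Dilate : ∀ {N n t} {V : Fin n → ℕPoint N} {α} → Units V t α → Dilate V t α
Units⇒Dilate (none α≗0) = Dilate-resp refl (λ j → sym (α≗0 j)) Dilate-zero
Units⇒Dilate (one v u eq) =
  Dilate-resp refl (λ j → sym (eq j)) (Dilate-+ (Dilate-vertex v) (Units⇒Dilate u))

Splits-∷ : ∀ {N n s k} {V : Fin n → ℕPoint N} {α β γ} → Dilate V s β → Splits V s k γ →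
  (∀ j → α j ≡ β j + γ j) → Splits V s (suc k) α
Splits-∷ {N} {s = s} {k} {V} {β = β} β∈ (βs , βs∈ , γ≡∑) α≡β+γ =
  β∷βs , β∷βs∈ , λ j → trans (α≡β+γ j) (cong (_+_ (β j)) (γ≡∑ j))
  where
  β∷βs : Fin (suc k) → ℕPoint N
  β∷βs zero    = β
  β∷βs (suc i) = βs i
  β∷βs∈ : ∀ i → Dilate V s (β∷βs i)
  β∷βs∈ zero    = β∈
  β∷βs∈ (suc i) = βs∈ i

Units⇒Splits : ∀ {N n} {V : Fin n → ℕPoint N} s k {α} → Units V (k * s) α → Splits V s k α
Units⇒Splits s zero (none α≗0) = (λ ()) , (λ ()) , α≗0
Units⇒Splits s (suc k) u with Units-split s u
... | β , γ , β-units , γ-units , α≡β+γ =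
  Splits-∷ {β = β} {γ = γ} (Units⇒Dilate β-units) (Units⇒Splits s k γ-units) α≡β+γ

-- The total exceeds its minimum `n * k` by one, so a term different from `k` takes up the whole
-- excess.
∑ℕ-exceptional : ∀ {n k} (f : Fin n → ℕ) → (∀ i → k ≤ f i) → ∑ℕ f ≡ suc (n * k) → ∃ λ i → f i ≡ suc k
∑ℕ-exceptional {suc n} {k} f k≤f ∑≡ with f zero ℕₚ.≟ k
... | yes f0≡k with ∑ℕ-exceptional (f ∘ suc) (k≤f ∘ suc)
      (ℕₚ.+-cancelˡ-≡ k _ _ (trans (cong (_+ ∑ℕ (f ∘ suc)) (sym f0≡k)) (trans ∑≡ (sym (ℕₚ.+-suc k (n * k))))))
...   | i , fi≡ = suc i , fi≡
∑ℕ-exceptional {suc n} {k} f k≤f ∑≡ | no f0≢k = zero , ℕₚ.≤-antisym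
  (ℕₚ.+-cancelʳ-≤ (n * k) (f zero) (suc k) (ℕₚ.≤-trans (ℕₚ.+-monoʳ-≤ (f zero) nk≤) (ℕₚ.≤-reflexive ∑≡)))
  (ℕₚ.≤∧≢⇒< (k≤f zero) (f0≢k ∘ sym))
  where
  nk≤ : n * k ≤ ∑ℕ (f ∘ suc)
  nk≤ = subst (_≤ ∑ℕ (f ∘ suc)) (∑ℕ-const {n} k (λ _ → refl)) (∑ℕ-mono (k≤f ∘ suc))

-- Prepending the coordinate 1 turns affine relations into linear ones, and `N + 2` vectors in
-- dimension `N + 1` are linearly dependent.
affinely-dependent : ∀ {N n} (V : Polytope N n) (f : Fin (suc (suc N)) → Fin n) → ¬ AffIndep (V ∘ f)
affinely-dependent {N} V f indep with linearly-dependent (suc N) homogenized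
  where
  homogenized : Fin (suc (suc N)) → Fin (suc N) → ℤ
  homogenized i zero    = + 1
  homogenized i (suc j) = V (f i) j
... | c , (i , ci≢0) , c-dep =
  ci≢0 (indep c (trans (∑ℤ-cong (λ i → sym (ℤₚ.*-identityʳ (c i)))) (c-dep zero)) (λ j → c-dep (suc j)) i)

argmin : ∀ {n} (f : Fin (suc n) → ℕ) → ∃ λ k → ∀ i → f k ≤ f i
argmin {zero}  f = zero , λ { zero → ℕₚ.≤-refl }
argmin {suc n} f with argmin (f ∘ suc)
... | k , k-min with ℕₚ.≤-total (f zero) (f (suc k))
...   | inj₁ f0≤fk = zero , λ { zero → ℕₚ.≤-refl ; (suc i) → ℕₚ.≤-trans f0≤fk (k-min i) }
...   | inj₂ fk≤f0 = suc k , λ { zero → fk≤f0 ; (suc i) → k-min i }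

-- The polytope and its facet inequalities

module Construction (D : ℕ) (2≤D : 2 ≤ D) (r : ℕ) (r≡3+D : r ≡ 3 + D) where

  e : ℕ
  e = suc D

  instance
    r-nonZero : NonZero r
    r-nonZero = subst NonZero (sym r≡3+D) _

  -- Lower endpoints of the segments over q, q₁ and the w_k; coordinate zero is the height z.
  low : Fin (2 + e) → ℕPoint (suc e)
  low zero          zero    = r
  low zero          (suc i) = 0
  low (suc zero)    zero    = 0
  low (suc zero)    (suc i) = 1
  low (suc (suc k)) zero    = 0
  low (suc (suc k)) (suc i) = δ k i

  raise : ℕ → ℕPoint (suc e) → ℕPoint (suc e)
  raise x α zero    = x + α zero
  raise x α (suc i) = α (suc i)

  vertex : Fin (2 + e) × Fin 2 → ℕPoint (suc e)
  vertex (l , ε) = raise (toℕ ε) (low l)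

  V : Fin ((2 + e) * 2) → ℕPoint (suc e)
  V i = vertex (remQuot 2 i)

  index : Fin (2 + e) → Fin 2 → Fin ((2 + e) * 2)
  index = combine

  V-index : ∀ l ε j → V (index l ε) j ≡ vertex (l , ε) j
  V-index l ε j = cong (λ lε → vertex lε j) (Finₚ.remQuot-combine l ε)

  Σp : ℕPoint (suc e) → ℕ
  Σp α = ∑ℕ (λ i → α (suc i))

  -- The facet inequalities of the cone in degree k, moved so that the coordinate k − Σp, which can be
  -- negative, does not occur.
  record Facets (k : ℕ) (α : ℕPoint (suc e)) : Set where
    field
      lower : r * k ≤ α zero + r * Σp α
      side  : ∀ i → Σp α ≤ k + D * α (suc i)
      upper : ∀ i → α zero + r * Σp α ≤ r * k + r * (D * α (suc i)) + k

  Σp-q₁ : ∀ ε → Σp (vertex (suc zero , ε)) ≡ e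
  Σp-q₁ ε = trans (∑ℕ-const {e} 1 (λ _ → refl)) (ℕₚ.*-identityʳ e)

  ε≤1 : ∀ (ε : Fin 2) → toℕ ε ≤ 1
  ε≤1 ε = ℕₚ.≤-pred (Finₚ.toℕ<n ε)

  vertex-lower : ∀ v → r * 1 ≤ vertex v zero + r * Σp (vertex v)
  vertex-lower (zero , ε) =
    subst (_≤ toℕ ε + r + r * Σp (vertex (zero , ε))) (sym (ℕₚ.*-identityʳ r))
      (ℕₚ.≤-trans (ℕₚ.m≤n+m r (toℕ ε)) (ℕₚ.m≤m+n (toℕ ε + r) _))
  vertex-lower (suc zero , ε) = ℕₚ.≤-trans
    (ℕₚ.*-monoʳ-≤ r (subst (1 ≤_) (sym (Σp-q₁ ε)) (s≤s z≤n)))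
    (ℕₚ.m≤n+m (r * Σp (vertex (suc zero , ε))) (toℕ ε + 0))
  vertex-lower (suc (suc k) , ε) = ℕₚ.≤-trans
    (ℕₚ.*-monoʳ-≤ r (ℕₚ.≤-reflexive (sym (∑ℕ-δ₁ k))))
    (ℕₚ.m≤n+m (r * ∑ℕ (δ k)) (toℕ ε + 0))

  vertex-side : ∀ i v → Σp (vertex v) ≤ 1 + D * vertex v (suc i)
  vertex-side i (zero , ε) =
    subst (_≤ 1 + D * 0) (sym (trans (∑ℕ-const {e} 0 (λ _ → refl)) (ℕₚ.*-zeroʳ e))) z≤n
  vertex-side i (suc zero , ε) =
    ℕₚ.≤-reflexive (trans (Σp-q₁ ε) (cong suc (sym (ℕₚ.*-identityʳ D))))
  vertex-side i (suc (suc k) , ε) =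
    subst (_≤ 1 + D * δ k i) (sym (∑ℕ-δ₁ k)) (s≤s z≤n)

  vertex-upper : ∀ i v → vertex v zero + r * Σp (vertex v) ≤ r * 1 + r * (D * vertex v (suc i)) + 1
  vertex-upper i (zero , ε) = begin
    toℕ ε + r + r * Σp (vertex (zero , ε))
      ≡⟨ cong (λ s → toℕ ε + r + r * s) (trans (∑ℕ-const {e} 0 (λ _ → refl)) (ℕₚ.*-zeroʳ e)) ⟩
    toℕ ε + r + r * 0         ≡⟨ rearrange (toℕ ε) r D ⟩
    r * 1 + r * (D * 0) + toℕ ε ≤⟨ ℕₚ.+-monoʳ-≤ (r * 1 + r * (D * 0)) (ε≤1 ε) ⟩
    r * 1 + r * (D * 0) + 1   ∎
    where
    open ℕₚ.≤-Reasoning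
    rearrange : ∀ x r D → x + r + r * 0 ≡ r * 1 + r * (D * 0) + x
    rearrange = solve-∀
  vertex-upper i (suc zero , ε) = begin
    toℕ ε + 0 + r * Σp (vertex (suc zero , ε)) ≡⟨ cong (λ s → toℕ ε + 0 + r * s) (Σp-q₁ ε) ⟩
    toℕ ε + 0 + r * (1 + D)     ≡⟨ rearrange (toℕ ε) r D ⟩
    r * 1 + r * (D * 1) + toℕ ε ≤⟨ ℕₚ.+-monoʳ-≤ (r * 1 + r * (D * 1)) (ε≤1 ε) ⟩
    r * 1 + r * (D * 1) + 1     ∎
    where
    open ℕₚ.≤-Reasoning
    rearrange : ∀ x r D → x + 0 + r * (1 + D) ≡ r * 1 + r * (D * 1) + x
    rearrange = solve-∀
  vertex-upper i (suc (suc k) , ε) = begin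
    toℕ ε + 0 + r * ∑ℕ (δ k)          ≡⟨ cong (λ s → toℕ ε + 0 + r * s) (∑ℕ-δ₁ k) ⟩
    toℕ ε + 0 + r * 1                 ≡⟨ rearrange (toℕ ε) r ⟩
    r * 1 + toℕ ε                     ≤⟨ ℕₚ.+-mono-≤ (ℕₚ.m≤m+n (r * 1) (r * (D * δ k i))) (ε≤1 ε) ⟩
    r * 1 + r * (D * δ k i) + 1       ∎
    where
    open ℕₚ.≤-Reasoning
    rearrange : ∀ x r → x + 0 + r * 1 ≡ r * 1 + x
    rearrange = solve-∀

  Dilate⇒Facets : ∀ {k α} → Dilate V k α → Facets k α
  Dilate⇒Facets α∈kP = record
    { lower = Dilate-≤ α∈kP (r ⊙ degree) (coord zero ⊕ r ⊙ σ) (λ v → vertex-lower (remQuot 2 v))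
    ; side  = λ i → Dilate-≤ α∈kP σ (degree ⊕ D ⊙ coord (suc i)) (λ v → vertex-side i (remQuot 2 v))
    ; upper = λ i → Dilate-≤ α∈kP (coord zero ⊕ r ⊙ σ) (r ⊙ degree ⊕ r ⊙ (D ⊙ coord (suc i)) ⊕ degree)
                      (λ v → vertex-upper i (remQuot 2 v))
    }
    where
    σ : Linear (suc e)
    σ = total (λ i → coord (suc i))

  -- Decomposition of cone points

  -- Moving `f` of the `t` summands to the upper ends of their unit segments adds `f` to the height
  -- and leaves the other coordinates alone.
  raise-units : ∀ {t f α} → f ≤ t → Units low t α → Units V t (raise f α)
  raise-units z≤n (none α≗0) = none λ { zero → α≗0 zero ; (suc j) → α≗0 (suc j) }
  raise-units z≤n (one {β = β} v u eq) = one (index v zero) (raise-units z≤n u) λ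
    { zero    → trans (eq zero) (cong (_+ β zero) (sym (V-index v zero zero)))
    ; (suc j) → trans (eq (suc j)) (cong (_+ β (suc j)) (sym (V-index v zero (suc j)))) }
  raise-units {f = suc f} (s≤s f≤t) (one {β = β} v u eq) = one (index v (suc zero)) (raise-units f≤t u) λ
    { zero    → trans (trans (cong (_+_ (suc f)) (eq zero)) (swap f (low v zero) (β zero)))
                  (cong (_+ (f + β zero)) (sym (V-index v (suc zero) zero)))
    ; (suc j) → trans (eq (suc j)) (cong (_+ β (suc j)) (sym (V-index v (suc zero) (suc j)))) }
    where
    swap : ∀ f v b → suc f + (v + b) ≡ 1 + v + (f + b)
    swap = solve-∀

  -- The lower endpoints taken with multiplicities `a`, `b₁`, `b₂` have height `r * b₂`, since only
  -- q lies above height zero; raising `f` of them reaches the required height.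
  fill : ∀ {t f α} (a : Fin e → ℕ) b₁ b₂ → t ≡ ∑ℕ a + b₁ + b₂ → α zero ≡ r * b₂ + f → f ≤ t →
    (∀ i → α (suc i) ≡ a i + b₁) → Units V t α
  fill {t} {f} {α} a b₁ b₂ t≡ z≡ f≤t p≡ =
    Units-resp refl point (raise-units f≤t (Units-resp size (λ _ → refl) (Units-combination (λ l → l) c)))
    where
    c : Fin (2 + e) → ℕ
    c zero          = b₂
    c (suc zero)    = b₁
    c (suc (suc i)) = a i
    size : ∑ℕ c ≡ t
    size = trans (swap b₂ b₁ (∑ℕ a)) (sym t≡)
      where
      swap : ∀ x y z → x + (y + z) ≡ z + y + x
      swap = solve-∀
    point : ∀ j → raise f (λ j → ∑ℕ (λ i → c i * low i j)) j ≡ α j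
    point zero = trans (cong (λ s → f + (b₂ * r + (b₁ * 0 + s)))
        (trans (∑ℕ-const 0 (λ i → ℕₚ.*-zeroʳ (a i))) (ℕₚ.*-zeroʳ e)))
      (trans (rearrange f b₂ r b₁) (sym z≡))
      where
      rearrange : ∀ f b₂ r b₁ → f + (b₂ * r + (b₁ * 0 + 0)) ≡ r * b₂ + f
      rearrange = solve-∀
    point (suc k) = trans (cong (λ s → b₂ * 0 + (b₁ * 1 + s))
        (trans (∑ℕ-cong (λ i → trans (ℕₚ.*-comm (a i) (δ i k)) (cong (_* a i) (δ-comm i k)))) (∑ℕ-δ k a)))
      (trans (rearrange b₂ b₁ (a k)) (sym (p≡ k)))
      where
      rearrange : ∀ b₂ b₁ x → b₂ * 0 + (b₁ * 1 + x) ≡ x + b₁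
      rearrange = solve-∀

  -- The lattice points over q₁ + i q. Since q lies over the origin, the level `i` is visible only
  -- in the degree `i + 1`, not in the coordinates.
  Y : ℕ → ℕPoint (suc e)
  Y z zero    = z
  Y z (suc i) = 1

  -- D r (z, (1,…,1)) = A Σ w_k + (r D − A) q₁ + D z q with A = r i − z.
  Y∈ : ∀ i z → i ≤ D → z ≤ r * i → Dilate V (suc i) (Y z)
  Y∈ i z i≤D z≤ri = Dilate-÷ (D * r) 1≤Dr (Units⇒Dilate
    (fill (λ _ → A) b₁ (D * z) size height z≤n (λ _ → trans (ℕₚ.*-identityʳ (D * r)) (trans (ℕₚ.*-comm D r) (sym A+b₁)))))
    where
    A b₁ : ℕ
    A = r * i ∸ z
    b₁ = r * D ∸ A
    A+b₁ : A + b₁ ≡ r * D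
    A+b₁ = ℕₚ.m+[n∸m]≡n (ℕₚ.≤-trans (ℕₚ.m∸n≤m (r * i) z) (ℕₚ.*-monoʳ-≤ r i≤D))
    A+z : A + z ≡ r * i
    A+z = ℕₚ.m∸n+n≡m z≤ri
    1≤Dr : 1 ≤ D * r
    1≤Dr = ℕₚ.*-mono-≤ (ℕₚ.≤-trans (s≤s z≤n) 2≤D) (subst (1 ≤_) (sym r≡3+D) (s≤s z≤n))
    height : D * r * z ≡ r * (D * z) + 0
    height = lem D r z
      where
      lem : ∀ D r z → D * r * z ≡ r * (D * z) + 0
      lem = solve-∀
    size : D * r * suc i ≡ ∑ℕ {e} (λ _ → A) + b₁ + D * z
    size = begin
      D * r * suc i             ≡⟨ lem₁ D r i ⟩
      D * (r * i) + r * D       ≡⟨ cong₂ (λ x y → D * x + y) (sym A+z) (sym A+b₁) ⟩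
      D * (A + z) + (A + b₁)    ≡⟨ lem₂ D A z b₁ ⟩
      (A + D * A) + b₁ + D * z  ≡⟨ cong (λ s → s + b₁ + D * z) (sym (∑ℕ-const {e} A (λ _ → refl))) ⟩
      ∑ℕ {e} (λ _ → A) + b₁ + D * z ∎
      where
      open ≡-Reasoning
      lem₁ : ∀ D r i → D * r * suc i ≡ D * (r * i) + r * D
      lem₁ = solve-∀
      lem₂ : ∀ D A z b → D * (A + z) + (A + b) ≡ (A + D * A) + b + D * z
      lem₂ = solve-∀

  -- In `core` the extra generator has level `1 + toℕ i`, hence degree `2 + toℕ i` between 2 and
  -- `D`, and height below `r`. The case `hole` is a single cone point.
  data Decomposition (t : ℕ) (α : ℕPoint (suc e)) : Set where
    units : Units V t α → Decomposition t α
    core  : ∀ (i : Fin (D ∸ 1)) (z : Fin r) {s β} → Units V s β →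
      t ≡ 2 + toℕ i + s → (∀ j → α j ≡ Y (toℕ z) j + β j) → Decomposition t α
    hole  : t ≡ e → (∀ j → α j ≡ Y (suc e) j) → Decomposition t α

  -- Induction on `b₁`, the number of copies of q₁ available for exchange. If the height is at least
  -- `r * b₂`, vertices suffice; otherwise copies of q have to be given up together with copies of
  -- q₁.
  decompose : ∀ b₁ (a : Fin e → ℕ) b₂ {t α} → t ≡ ∑ℕ a + b₁ + b₂ → (∀ i → α (suc i) ≡ a i + b₁) →
    r * b₂ ≤ α zero + r * (D * b₁) → α zero ≤ r * b₂ + t → Decomposition t α
  decompose b₁ a b₂ {t} {α} t≡ p≡ low≤ ≤up with r * b₂ ℕₚ.≤? α zero
  ... | yes rb₂≤z =
    units (fill a b₁ b₂ t≡ (sym (ℕₚ.m+[n∸m]≡n rb₂≤z)) (ℕₚ.m≤n+o⇒m∸n≤o (α zero) (r * b₂) ≤up) p≡)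
  -- Without any q₁ the lower facet already gives `r * b₂ ≤ α zero`.
  decompose zero a b₂ {t} {α} t≡ p≡ low≤ ≤up | no rb₂≰z = contradiction (ℕₚ.≤-trans low≤
    (ℕₚ.≤-reflexive (trans (cong (λ x → α zero + r * x) (ℕₚ.*-zeroʳ D))
      (trans (cong (_+_ (α zero)) (ℕₚ.*-zeroʳ r)) (ℕₚ.+-identityʳ (α zero)))))) rb₂≰z
  decompose (suc b₁) a b₂ {t} {α} t≡ p≡ low≤ ≤up | no rb₂≰z = cases (ℕₚ.<-cmp (suc i) D)
    where
    z c ρ : ℕ
    z = α zero
    c = z / r
    ρ = z % r
    z≡ : z ≡ r * c + ρ
    z≡ = trans (m≡m%n+[m/n]*n z r) (trans (ℕₚ.+-comm ρ (c * r)) (cong (_+ ρ) (ℕₚ.*-comm c r)))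
    ρ<r : ρ < r
    ρ<r = m%n<n z r
    c<b₂ : c < b₂
    c<b₂ = ℕₚ.*-cancelˡ-< r c b₂
      (ℕₚ.≤-<-trans (ℕₚ.≤-trans (ℕₚ.m≤m+n (r * c) ρ) (ℕₚ.≤-reflexive (sym z≡))) (ℕₚ.≰⇒> rb₂≰z))
    -- The number `1 + i` is the least number of copies of q whose removal brings `r * b₂` down to
    -- at most `z`; then `c` copies remain.
    gap = ℕₚ.m≤n⇒∃[o]m+o≡n c<b₂
    i : ℕ
    i = proj₁ gap
    b₂≡ : suc c + i ≡ b₂
    b₂≡ = proj₂ gap
    ∑suc : ∑ℕ (λ j → suc (a j)) ≡ e + ∑ℕ a
    ∑suc = trans (∑ℕ-+ (λ _ → 1) a)
      (cong (_+ ∑ℕ a) (trans (∑ℕ-const {e} 1 (λ _ → refl)) (ℕₚ.*-identityʳ e)))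
    cases : _ → Decomposition t α
    -- One q₁ and `1 + i` copies of q are replaced by the lattice point of height `ρ` over their
    -- sum. What is left has height exactly `r * c`, so lower endpoints suffice.
    cases (tri< i<D _ _) = core (fromℕ< i<D∸1) (fromℕ< ρ<r) rest size point
      where
      i<D∸1 : i < D ∸ 1
      i<D∸1 = ℕₚ.∸-monoˡ-≤ 1 i<D
      β : ℕPoint (suc e)
      β zero    = r * c
      β (suc j) = a j + b₁
      rest : Units V (∑ℕ a + b₁ + c) β
      rest = fill a b₁ c refl (sym (ℕₚ.+-identityʳ (r * c))) z≤n (λ _ → refl)
      lem : ∀ x b c i → x + suc b + (suc c + i) ≡ 2 + i + (x + b + c)
      lem = solve-∀
      size : t ≡ 2 + toℕ (fromℕ< i<D∸1) + (∑ℕ a + b₁ + c)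
      size = trans t≡ (trans (cong (_+_ (∑ℕ a + suc b₁)) (sym b₂≡)) (trans (lem (∑ℕ a) b₁ c i)
        (cong (λ x → 2 + x + (∑ℕ a + b₁ + c)) (sym (Finₚ.toℕ-fromℕ< i<D∸1)))))
      point : ∀ j → α j ≡ Y (toℕ (fromℕ< ρ<r)) j + β j
      point zero = trans z≡ (trans (ℕₚ.+-comm (r * c) ρ) (cong (_+ r * c) (sym (Finₚ.toℕ-fromℕ< ρ<r))))
      point (suc j) = trans (p≡ j) (ℕₚ.+-suc (a j) b₁)
    -- Exactly `D` copies: q₁ + D q is exchanged for the sum of the `w_k`. The base height becomes
    -- `r * c`, and the remainder `ρ` must be made up by raising summands, which works precisely for
    -- `ρ ≤ t`.
    cases (tri≈ _ i≡D _) = by-height (ρ ℕₚ.≤? t)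
      where
      t≡e+ : t ≡ e + (∑ℕ a + b₁ + c)
      t≡e+ = trans t≡ (trans (cong (_+_ (∑ℕ a + suc b₁)) (sym b₂≡))
        (trans (lem (∑ℕ a) b₁ c i) (cong (λ x → suc x + (∑ℕ a + b₁ + c)) i≡D)))
        where
        lem : ∀ x b c i → x + suc b + (suc c + i) ≡ suc (suc i) + (x + b + c)
        lem = solve-∀
      by-height : _ → Decomposition t α
      by-height (yes ρ≤t) = units (fill (λ j → suc (a j)) b₁ c
        (trans t≡e+ (trans (lem e (∑ℕ a) b₁ c) (cong (λ s → s + b₁ + c) (sym ∑suc))))
        z≡ ρ≤t (λ j → trans (p≡ j) (ℕₚ.+-suc (a j) b₁)))
        where
        lem : ∀ e x b c → e + (x + b + c) ≡ e + x + b + c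
        lem = solve-∀
      by-height (no ρ≰t) = hole t≡e point
        where
        -- As `r = e + 2` and `t ≥ e`, the failure of `ρ ≤ t` leaves only `t = e` and `ρ = e + 1`.
        -- Then all remaining multiplicities vanish.
        ρ≤1+e : ρ ≤ suc e
        ρ≤1+e = ℕₚ.≤-pred (subst (ρ <_) r≡3+D ρ<r)
        t≡e : t ≡ e
        t≡e = ℕₚ.≤-antisym (ℕₚ.≤-pred (ℕₚ.≤-trans (ℕₚ.≰⇒> ρ≰t) ρ≤1+e))
          (subst (e ≤_) (sym t≡e+) (ℕₚ.m≤m+n e _))
        rest≡0 : ∑ℕ a + b₁ + c ≡ 0
        rest≡0 = ℕₚ.+-cancelˡ-≡ e _ _ (trans (sym t≡e+) (trans t≡e (sym (ℕₚ.+-identityʳ e))))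
        a+b₁≡0 : ∑ℕ a + b₁ ≡ 0
        a+b₁≡0 = ℕₚ.m+n≡0⇒m≡0 (∑ℕ a + b₁) rest≡0
        point : ∀ j → α j ≡ Y (suc e) j
        point zero = trans z≡ (trans (cong (λ x → r * x + ρ) (ℕₚ.m+n≡0⇒n≡0 (∑ℕ a + b₁) rest≡0))
          (trans (cong (_+ ρ) (ℕₚ.*-zeroʳ r))
            (ℕₚ.≤-antisym ρ≤1+e (subst (λ t → suc t ≤ ρ) t≡e (ℕₚ.≰⇒> ρ≰t)))))
        point (suc j) = trans (p≡ j) (cong₂ (λ x y → x + suc y)
          (∑ℕ≡0⇒≡0 a (ℕₚ.m+n≡0⇒m≡0 (∑ℕ a) a+b₁≡0) j) (ℕₚ.m+n≡0⇒n≡0 (∑ℕ a) a+b₁≡0))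
    -- After one exchange the lower height `r * b₂′` is still not below `z`, so the upper bound is
    -- automatic; the lower bound loses `r * D` on both sides.
    cases (tri> _ _ D<i) = decompose b₁ (λ j → suc (a j)) b₂′
      (trans t≡ (trans (cong (_+_ (∑ℕ a + suc b₁)) (sym b₂′≡)) (trans (lem D (∑ℕ a) b₁ b₂′)
        (cong (λ s → s + b₁ + b₂′) (sym ∑suc)))))
      (λ j → trans (p≡ j) (ℕₚ.+-suc (a j) b₁))
      (ℕₚ.+-cancelˡ-≤ (r * D) _ _ (begin
        r * D + r * b₂′           ≡⟨ sym (ℕₚ.*-distribˡ-+ r D b₂′) ⟩
        r * (D + b₂′)             ≡⟨ cong (r *_) b₂′≡ ⟩
        r * b₂                    ≤⟨ low≤ ⟩
        z + r * (D * suc b₁)      ≡⟨ lem₂ z r D b₁ ⟩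
        r * D + (z + r * (D * b₁)) ∎))
      (begin
        z            ≡⟨ z≡ ⟩
        r * c + ρ    ≤⟨ ℕₚ.+-monoʳ-≤ (r * c) (ℕₚ.<⇒≤ ρ<r) ⟩
        r * c + r    ≡⟨ lem₃ r c ⟩
        r * suc c    ≤⟨ ℕₚ.*-monoʳ-≤ r c<b₂′ ⟩
        r * b₂′      ≤⟨ ℕₚ.m≤m+n (r * b₂′) t ⟩
        r * b₂′ + t  ∎)
      where
      open ℕₚ.≤-Reasoning
      excess = ℕₚ.m≤n⇒∃[o]m+o≡n (ℕₚ.≤-pred D<i)
      o b₂′ : ℕ
      o = proj₁ excess
      b₂′ = suc c + o
      b₂′≡ : D + b₂′ ≡ b₂
      b₂′≡ = trans (lem₁ D c o) (trans (cong (_+_ (suc c)) (proj₂ excess)) b₂≡)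
        where
        lem₁ : ∀ D c o → D + (suc c + o) ≡ suc c + (D + o)
        lem₁ = solve-∀
      c<b₂′ : suc c ≤ b₂′
      c<b₂′ = ℕₚ.m≤m+n (suc c) o
      lem : ∀ D x b y → x + suc b + (D + y) ≡ suc D + x + b + y
      lem = solve-∀
      lem₂ : ∀ z r D b → z + r * (D * suc b) ≡ r * D + (z + r * (D * b))
      lem₂ = solve-∀
      lem₃ : ∀ r c → r * c + r ≡ r * suc c
      lem₃ = solve-∀

  -- Taking `b₁` as the least of the p-coordinates makes all `a i` nonnegative. At the coordinate
  -- where the minimum is attained, `side` says that `b₂` is a genuine difference and `upper` bounds
  -- the height by `r * b₂ + k`; `lower` supplies the remaining hypothesis of `decompose`.
  Facets⇒Decomposition : ∀ {k α} → Facets k α → Decomposition k α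
  Facets⇒Decomposition {k} {α} facets = decompose b₁ a b₂
    (sym (ℕₚ.m+[n∸m]≡n a+b₁≤k))
    (λ i → sym (ℕₚ.m∸n+n≡m (proj₂ min i)))
    (ℕₚ.+-cancelˡ-≤ (r * (∑ℕ a + b₁)) _ _ (begin
      r * (∑ℕ a + b₁) + r * b₂    ≡⟨ sym (ℕₚ.*-distribˡ-+ r (∑ℕ a + b₁) b₂) ⟩
      r * (∑ℕ a + b₁ + b₂)        ≡⟨ cong (r *_) (ℕₚ.m+[n∸m]≡n a+b₁≤k) ⟩
      r * k                       ≤⟨ lower ⟩
      α zero + r * Σp α           ≡⟨ cong (λ s → α zero + r * s) Σp≡ ⟩
      α zero + r * (∑ℕ a + b₁ + D * b₁) ≡⟨ lem₁ (α zero) r (∑ℕ a + b₁) (D * b₁) ⟩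
      r * (∑ℕ a + b₁) + (α zero + r * (D * b₁)) ∎))
    (ℕₚ.+-cancelˡ-≤ (r * (∑ℕ a + b₁ + D * b₁)) _ _ (begin
      r * (∑ℕ a + b₁ + D * b₁) + α zero ≡⟨ ℕₚ.+-comm _ (α zero) ⟩
      α zero + r * (∑ℕ a + b₁ + D * b₁) ≡⟨ cong (λ s → α zero + r * s) (sym Σp≡) ⟩
      α zero + r * Σp α           ≤⟨ upper (proj₁ min) ⟩
      r * k + r * (D * b₁) + k    ≡⟨ cong (λ x → r * x + r * (D * b₁) + k) (sym (ℕₚ.m+[n∸m]≡n a+b₁≤k)) ⟩
      r * (∑ℕ a + b₁ + b₂) + r * (D * b₁) + k ≡⟨ lem₂ r (∑ℕ a + b₁) b₂ (D * b₁) k ⟩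
      r * (∑ℕ a + b₁ + D * b₁) + (r * b₂ + k) ∎))
    where
    open Facets facets
    open ℕₚ.≤-Reasoning
    min = argmin (λ i → α (suc i))
    b₁ : ℕ
    b₁ = α (suc (proj₁ min))
    a : Fin e → ℕ
    a i = α (suc i) ∸ b₁
    Σp≡ : Σp α ≡ ∑ℕ a + b₁ + D * b₁
    Σp≡ = trans (∑ℕ-cong (λ i → sym (ℕₚ.m∸n+n≡m (proj₂ min i))))
      (trans (∑ℕ-+ a (λ _ → b₁)) (trans (cong (_+_ (∑ℕ a)) (∑ℕ-const {e} b₁ (λ _ → refl)))
        (sym (ℕₚ.+-assoc (∑ℕ a) b₁ (D * b₁)))))
    a+b₁≤k : ∑ℕ a + b₁ ≤ k
    a+b₁≤k = ℕₚ.+-cancelʳ-≤ (D * b₁) _ _ (subst (_≤ k + D * b₁) Σp≡ (side (proj₁ min)))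
    b₂ : ℕ
    b₂ = k ∸ (∑ℕ a + b₁)
    lem₁ : ∀ z r x y → z + r * (x + y) ≡ r * x + (z + r * y)
    lem₁ = solve-∀
    lem₂ : ∀ r x b y k → r * (x + b) + r * y + k ≡ r * (x + y) + (r * b + k)
    lem₂ = solve-∀

  -- Integer decomposition property of the dilates

  2≤r : 2 ≤ r
  2≤r = subst (2 ≤_) (sym r≡3+D) (s≤s (s≤s z≤n))

  2+i≤D : ∀ (i : Fin (D ∸ 1)) → 2 + toℕ i ≤ D
  2+i≤D i = subst (2 + toℕ i ≤_) (ℕₚ.m+[n∸m]≡n (ℕₚ.<⇒≤ 2≤D)) (s≤s (Finₚ.toℕ<n i))

  core∈ : ∀ (i : Fin (D ∸ 1)) (z : Fin r) → Dilate V (2 + toℕ i) (Y (toℕ z))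
  core∈ i z = Y∈ (suc (toℕ i)) (toℕ z) (ℕₚ.<⇒≤ (2+i≤D i))
    (ℕₚ.≤-trans (ℕₚ.<⇒≤ (Finₚ.toℕ<n z)) (ℕₚ.m≤m*n r (suc (toℕ i))))

  -- Sums of vertices are cut into blocks of length `n`. A core generator has degree at most `D ≤ n`
  -- and is padded with vertices to one block. The hole cannot occur: its degree `D + 1` is at most
  -- `n + 1`, which is less than `2 * n`.
  IDP-from-D : ∀ n → D ≤ n → IDP (scale n (embed V))
  IDP-from-D n D≤n = splits⇒IDP n (ℕₚ.≤-trans (ℕₚ.<⇒≤ 2≤D) D≤n)
    (λ k α α∈ → split k α (Facets⇒Decomposition (Dilate⇒Facets α∈)))
    where
    split : ∀ k α → Decomposition (suc (suc k) * n) α → Splits V n (suc (suc k)) α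
    split k α (units u) = Units⇒Splits n (suc (suc k)) u
    split k α (core i z {s} {β} u t≡ α≡) with Units-split o {suc k * n} (Units-resp s≡ (λ _ → refl) u)
      where
      o : ℕ
      o = n ∸ (2 + toℕ i)
      s≡ : s ≡ o + suc k * n
      s≡ = ℕₚ.+-cancelˡ-≡ (2 + toℕ i) _ _ (trans (sym t≡)
        (trans (cong (_+ suc k * n) (sym (ℕₚ.m+[n∸m]≡n (ℕₚ.≤-trans (2+i≤D i) D≤n))))
          (ℕₚ.+-assoc (2 + toℕ i) o (suc k * n))))
    ... | β₁ , β₂ , u₁ , u₂ , β≡ = Splits-∷ {γ = β₂}
      (Dilate-resp (ℕₚ.m+[n∸m]≡n (ℕₚ.≤-trans (2+i≤D i) D≤n)) (λ _ → refl)
        (Dilate-+ (core∈ i z) (Units⇒Dilate u₁)))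
      (Units⇒Splits n (suc k) u₂)
      (λ j → trans (α≡ j) (trans (cong (_+_ (Y (toℕ z) j)) (β≡ j))
        (sym (ℕₚ.+-assoc (Y (toℕ z) j) (β₁ j) (β₂ j)))))
    split k α (hole t≡e _) = contradiction (ℕₚ.≤-trans 2≤D D≤n) (ℕₚ.<⇒≱ (s≤s n≤1))
      where
      n≤1 : n ≤ 1
      n≤1 = ℕₚ.+-cancelˡ-≤ n n 1 (ℕₚ.≤-trans (ℕₚ.+-monoʳ-≤ n (ℕₚ.m≤m+n n (k * n)))
        (ℕₚ.≤-trans (ℕₚ.≤-reflexive t≡e) (ℕₚ.≤-trans (s≤s D≤n) (ℕₚ.≤-reflexive (ℕₚ.+-comm 1 n)))))

  module NoSplitting (k : ℕ) (1≤k : 1 ≤ k) (k<D : k < D) where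

    -- The point (0, (1,...,1)) has degree `D`; adding `x` copies of `w₀` brings the degree to
    -- `D * k`, to be shared by `D` pieces of degree `k`.
    x : ℕ
    x = D * k ∸ D

    D+x : D + x ≡ D * k
    D+x = ℕₚ.m+[n∸m]≡n (ℕₚ.m≤m*n D k {{>-nonZero 1≤k}})

    xw₀ witness : ℕPoint (suc e)
    xw₀ zero    = 0
    xw₀ (suc j) = δ zero j * x
    witness j = Y 0 j + xw₀ j

    witness∈ : Dilate V (D * k) witness
    witness∈ = Dilate-resp (trans (cong (_+ x) (ℕₚ.m+[n∸m]≡n (ℕₚ.<⇒≤ 2≤D))) D+x) (λ _ → refl)
      (Dilate-+ (Y∈ (D ∸ 1) 0 (ℕₚ.m∸n≤m D 1) z≤n) (Units⇒Dilate xw₀∈))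
      where
      xw₀∈ : Units V x xw₀
      xw₀∈ = fill (λ j → δ zero j * x) 0 0
        (sym (trans (ℕₚ.+-identityʳ _) (trans (ℕₚ.+-identityʳ _) (∑ℕ-δ {e} zero (λ _ → x)))))
        (sym (trans (ℕₚ.+-identityʳ _) (ℕₚ.*-zeroʳ r))) z≤n (λ j → sym (ℕₚ.+-identityʳ _))

    -- All pieces have height zero, so `lower` forces p-sum at least `k` on each, while the total is
    -- `D * k + 1`. Exactly one piece has p-sum `k + 1`, and `side` makes all its `e` coordinates
    -- positive. Hence `e ≤ k + 1`, against `k < D`.
    no-splitting : ¬ Splits V k D witness
    no-splitting (β , β∈ , witness≡∑β) = ℕₚ.<⇒≱ k<D (ℕₚ.≤-pred e≤1+k)
      where
      facets : ∀ i → Facets k (β i)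
      facets i = Dilate⇒Facets (β∈ i)
      height≡0 : ∀ i → β i zero ≡ 0
      height≡0 = ∑ℕ≡0⇒≡0 (λ i → β i zero) (sym (witness≡∑β zero))
      k≤Σp : ∀ i → k ≤ Σp (β i)
      k≤Σp i = ℕₚ.*-cancelˡ-≤ r
        (subst (λ z → r * k ≤ z + r * Σp (β i)) (height≡0 i) (Facets.lower (facets i)))
      ∑Σp : ∑ℕ (λ i → Σp (β i)) ≡ suc (D * k)
      ∑Σp = begin
        ∑ℕ (λ i → Σp (β i))                ≡⟨ ∑ℕ-swap (λ i j → β i (suc j)) ⟩
        ∑ℕ (λ j → ∑ℕ (λ i → β i (suc j)))  ≡⟨ ∑ℕ-cong (λ j → sym (witness≡∑β (suc j))) ⟩
        ∑ℕ {e} (λ j → 1 + δ zero j * x)    ≡⟨ ∑ℕ-+ {e} (λ _ → 1) (λ j → δ zero j * x) ⟩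
        ∑ℕ {e} (λ _ → 1) + ∑ℕ {e} (λ j → δ zero j * x)
          ≡⟨ cong₂ _+_ (trans (∑ℕ-const {e} 1 (λ _ → refl)) (ℕₚ.*-identityʳ e)) (∑ℕ-δ {e} zero (λ _ → x)) ⟩
        suc (D + x)                        ≡⟨ cong suc D+x ⟩
        suc (D * k)                        ∎
        where open ≡-Reasoning
      exceptional = ∑ℕ-exceptional (λ i → Σp (β i)) k≤Σp ∑Σp
      i₀ : Fin D
      i₀ = proj₁ exceptional
      p≥1 : ∀ j → 1 ≤ β i₀ (suc j)
      p≥1 j = ℕₚ.n≢0⇒n>0 λ βj≡0 → contradiction
        (subst₂ (λ s y → s ≤ k + D * y) (proj₂ exceptional) βj≡0 (Facets.side (facets i₀) j))
        (ℕₚ.<⇒≱ (s≤s (ℕₚ.≤-reflexive (trans (cong (_+_ k) (ℕₚ.*-zeroʳ D)) (ℕₚ.+-identityʳ k)))))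
      e≤1+k : e ≤ suc k
      e≤1+k = subst₂ _≤_ (trans (∑ℕ-const {e} 1 (λ _ → refl)) (ℕₚ.*-identityʳ e)) (proj₂ exceptional)
        (∑ℕ-mono p≥1)

  ¬IDP-below-D : ∀ k → 1 ≤ k → k < D → ¬ IDP (scale k (embed V))
  ¬IDP-below-D k 1≤k k<D idp =
    no-splitting (IDP⇒splits k 1≤k idp D witness (ℕₚ.<⇒≤ 2≤D) witness∈)
    where open NoSplitting k 1≤k k<D

  -- Dimension of the polytope

  -- Both ends of the segment over q and the lower ends over the `w_k` are affinely independent: the
  -- p-coordinates isolate each `w_k`, and the height relation minus `r` times the weight relation
  -- isolates the upper end over q.
  V-dim : Dim (embed V) (suc e)
  V-dim = (f , f-indep) , affinely-dependent (embed V)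
    where
    f : Fin (2 + e) → Fin ((2 + e) * 2)
    f zero          = index zero (suc zero)
    f (suc zero)    = index zero zero
    f (suc (suc k)) = index (suc (suc k)) zero
    f-indep : AffIndep (embed V ∘ f)
    f-indep c ∑c≡0 c-dep = c≡0
      where
      w-indep : ∀ k → c (suc (suc k)) ≡ + 0
      w-indep k = begin
        c (suc (suc k)) ≡⟨ sym (∑ℤ-δ k (λ i → c (suc (suc i)))) ⟩
        s               ≡⟨ lem (c zero) (c (suc zero)) s ⟩
        c zero ℤ.* + 0 ℤ.+ (c (suc zero) ℤ.* + 0 ℤ.+ s)
          ≡⟨ sym (cong₂ ℤ._+_ (term zero zero (suc zero))
               (cong₂ ℤ._+_ (term (suc zero) zero zero) (∑ℤ-cong (λ i → term (suc (suc i)) (suc (suc i)) zero)))) ⟩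
        ∑ℤ (λ i → c i ℤ.* + V (f i) (suc k)) ≡⟨ c-dep (suc k) ⟩
        + 0 ∎
        where
        open ≡-Reasoning
        s : ℤ
        s = ∑ℤ (λ i → c (suc (suc i)) ℤ.* + δ i k)
        lem : ∀ x y s → s ≡ x ℤ.* + 0 ℤ.+ (y ℤ.* + 0 ℤ.+ s)
        lem = ℤSolver.solve-∀
        term : ∀ i l ε → c i ℤ.* + V (index l ε) (suc k) ≡ c i ℤ.* + low l (suc k)
        term i l ε = cong (λ v → c i ℤ.* + v) (V-index l ε (suc k))
      opposite : c zero ℤ.+ (c (suc zero) ℤ.+ + 0) ≡ + 0
      opposite = trans (cong (λ s → c zero ℤ.+ (c (suc zero) ℤ.+ s)) (sym (∑ℤ-zero w-indep))) ∑c≡0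
      heights : c zero ℤ.* (+ 1 ℤ.+ + r) ℤ.+ (c (suc zero) ℤ.* + r ℤ.+ + 0) ≡ + 0
      heights = trans (sym (cong₂ ℤ._+_ (cong (λ v → c zero ℤ.* + v) (V-index zero (suc zero) zero))
        (cong₂ ℤ._+_ (cong (λ v → c (suc zero) ℤ.* + v) (V-index zero zero zero))
          (∑ℤ-zero (λ i → trans (cong (ℤ._* (+ V (f (suc (suc i))) zero)) (w-indep i)) (ℤₚ.*-zeroˡ (+ V (f (suc (suc i))) zero)))))))
        (c-dep zero)
      c₀≡0 : c zero ≡ + 0
      c₀≡0 = begin
        c zero ≡⟨ lem (c zero) (c (suc zero)) (+ r) ⟩
        (c zero ℤ.* (+ 1 ℤ.+ + r) ℤ.+ (c (suc zero) ℤ.* + r ℤ.+ + 0)) ℤ.- (c zero ℤ.+ (c (suc zero) ℤ.+ + 0)) ℤ.* + r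
          ≡⟨ cong₂ (λ x y → x ℤ.- y ℤ.* + r) heights opposite ⟩
        + 0 ℤ.- + 0 ℤ.* + r ≡⟨ cong (λ x → + 0 ℤ.- x) (ℤₚ.*-zeroˡ (+ r)) ⟩
        + 0 ∎
        where
        open ≡-Reasoning
        lem : ∀ x y r → x ≡ (x ℤ.* (+ 1 ℤ.+ r) ℤ.+ (y ℤ.* r ℤ.+ + 0)) ℤ.- (x ℤ.+ (y ℤ.+ + 0)) ℤ.* r
        lem = ℤSolver.solve-∀
      c≡0 : ∀ i → c i ≡ + 0
      c≡0 zero          = c₀≡0
      c≡0 (suc zero)    = trans (lem (c zero) (c (suc zero))) (cong₂ ℤ._-_ opposite c₀≡0)
        where
        lem : ∀ x y → y ≡ (x ℤ.+ (y ℤ.+ + 0)) ℤ.- x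
        lem = ℤSolver.solve-∀
      c≡0 (suc (suc k)) = w-indep k

  -- Hilbert basis

  -- The generators over q₁ + i q, where i is the level.
  Column : Set
  Column = Fin 2 ⊎ ((Fin (D ∸ 1) × Fin r) ⊎ Fin 1)

  level height : Column → ℕ
  level (inj₁ ε)              = 0
  level (inj₂ (inj₁ (i , z))) = suc (toℕ i)
  level (inj₂ (inj₂ _))       = D
  height (inj₁ ε)              = toℕ ε
  height (inj₂ (inj₁ (i , z))) = toℕ z
  height (inj₂ (inj₂ _))       = suc e

  level≤D : ∀ y → level y ≤ D
  level≤D (inj₁ ε)              = z≤n
  level≤D (inj₂ (inj₁ (i , z))) = ℕₚ.<⇒≤ (2+i≤D i)
  level≤D (inj₂ (inj₂ _))       = ℕₚ.≤-refl

  height<r : ∀ y → height y < r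
  height<r (inj₁ ε)              = ℕₚ.≤-trans (Finₚ.toℕ<n ε) 2≤r
  height<r (inj₂ (inj₁ (i , z))) = Finₚ.toℕ<n z
  height<r (inj₂ (inj₂ _))       = ℕₚ.≤-reflexive (sym r≡3+D)

  0≢D : 0 ≢ D
  0≢D 0≡D = contradiction (subst (2 ≤_) (sym 0≡D) 2≤D) λ ()

  suc≢D : ∀ (i : Fin (D ∸ 1)) → suc (toℕ i) ≢ D
  suc≢D i 1+i≡D = ℕₚ.<⇒≢ (2+i≤D i) 1+i≡D

  top-height : ∀ y → level y ≡ D → height y ≡ suc e
  top-height (inj₁ ε)              eq = contradiction eq 0≢D
  top-height (inj₂ (inj₁ (i , z))) eq = contradiction eq (suc≢D i)
  top-height (inj₂ (inj₂ _))       eq = refl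

  column-injective : ∀ y y′ → level y ≡ level y′ → height y ≡ height y′ → y ≡ y′
  column-injective (inj₁ ε) (inj₁ ε′) _ h = cong inj₁ (Finₚ.toℕ-injective h)
  column-injective (inj₁ ε) (inj₂ (inj₂ _)) l _ = contradiction l 0≢D
  column-injective (inj₂ (inj₁ (i , z))) (inj₂ (inj₁ (i′ , z′))) l h =
    cong₂ (λ i z → inj₂ (inj₁ (i , z))) (Finₚ.toℕ-injective (ℕₚ.suc-injective l)) (Finₚ.toℕ-injective h)
  column-injective (inj₂ (inj₁ (i , z))) (inj₂ (inj₂ _)) l _ = contradiction l (suc≢D i)
  column-injective (inj₂ (inj₂ _)) (inj₁ ε) l _ = contradiction (sym l) 0≢D
  column-injective (inj₂ (inj₂ _)) (inj₂ (inj₁ (i , z))) l _ = contradiction (sym l) (suc≢D i)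
  column-injective (inj₂ (inj₂ zero)) (inj₂ (inj₂ zero)) _ _ = refl

  -- The vertices over q₁ are counted as the columns of level 0, so that they are compared with the
  -- other points of p-part (1,...,1) uniformly.
  Generator : Set
  Generator = (Fin e × Fin 2) ⊎ (Fin 2 ⊎ Column)

  pattern w k ε = inj₁ (k , ε)
  pattern q ε   = inj₂ (inj₁ ε)
  pattern col y = inj₂ (inj₂ y)

  deg : Generator → ℕ
  deg (w k ε) = 1
  deg (q ε)   = 1
  deg (col y) = suc (level y)

  pt : Generator → ℕPoint (suc e)
  pt (w k ε) = vertex (suc (suc k) , ε)
  pt (q ε)   = vertex (zero , ε)
  pt (col y) = Y (height y)

  vertex-generator : ∀ l ε → Σ Generator λ g → deg g ≡ 1 × (∀ j → pt g j ≡ vertex (l , ε) j)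
  vertex-generator zero          ε = q ε , refl , λ _ → refl
  vertex-generator (suc zero)    ε = col (inj₁ ε) , refl ,
    λ { zero → sym (ℕₚ.+-identityʳ (toℕ ε)) ; (suc j) → refl }
  vertex-generator (suc (suc k)) ε = w k ε , refl , λ _ → refl

  vertex∈ : ∀ l ε → Dilate V 1 (vertex (l , ε))
  vertex∈ l ε = Dilate-resp refl (V-index l ε) (Dilate-vertex (index l ε))

  pt∈ : ∀ g → Dilate V (deg g) (pt g)
  pt∈ (w k ε) = vertex∈ (suc (suc k)) ε
  pt∈ (q ε)   = vertex∈ zero ε
  pt∈ (col (inj₁ ε)) =
    Dilate-resp refl (λ { zero → ℕₚ.+-identityʳ (toℕ ε) ; (suc j) → refl }) (vertex∈ (suc zero) ε)
  pt∈ (col (inj₂ (inj₁ (i , z)))) = core∈ i z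
  pt∈ (col (inj₂ (inj₂ _))) = Y∈ D (suc e) ℕₚ.≤-refl
    (ℕₚ.≤-trans (ℕₚ.<⇒≤ (height<r (inj₂ (inj₂ zero)))) (ℕₚ.m≤m*n r D {{>-nonZero (ℕₚ.<⇒≤ 2≤D)}}))

  deg≤e : ∀ g → deg g ≤ e
  deg≤e (w k ε) = s≤s z≤n
  deg≤e (q ε)   = s≤s z≤n
  deg≤e (col y) = s≤s (level≤D y)

  deg≡suc : ∀ g → ∃ λ x → deg g ≡ suc x
  deg≡suc (w k ε) = 0 , refl
  deg≡suc (q ε)   = 0 , refl
  deg≡suc (col y) = level y , refl

  vanishing-height : ∀ {k ρ} → Facets k ρ → k ≡ 0 → ∀ j → ρ (suc j) ≡ 0 → ρ zero ≡ 0
  vanishing-height {ρ = ρ} facets refl j ρj≡0 = ℕₚ.n≤0⇒n≡0 (begin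
    ρ zero                                 ≤⟨ ℕₚ.m≤m+n (ρ zero) (r * Σp ρ) ⟩
    ρ zero + r * Σp ρ                      ≤⟨ Facets.upper facets j ⟩
    r * 0 + r * (D * ρ (suc j)) + 0        ≡⟨ cong (λ y → r * 0 + r * (D * y) + 0) ρj≡0 ⟩
    r * 0 + r * (D * 0) + 0                ≡⟨ lem r D ⟩
    0                                      ∎)
    where
    open ℕₚ.≤-Reasoning
    lem : ∀ r D → r * 0 + r * (D * 0) + 0 ≡ 0
    lem = solve-∀

  Σp-Y : ∀ z → Σp (Y z) ≡ e
  Σp-Y z = trans (∑ℕ-const {e} 1 (λ _ → refl)) (ℕₚ.*-identityʳ e)

  -- Irreducibility of the generators: if subtracting `g′` from `g` leaves a point satisfying the
  -- facet inequalities, nothing is left. Most mixed cases fail already in the p-coordinates or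
  -- because q has height `r`.
  indecomposable : ∀ g g′ {k ρ} → Facets k ρ → deg g ≡ deg g′ + k →
    (∀ j → pt g j ≡ pt g′ j + ρ j) → g ≡ g′
  indecomposable (w k ε) (w k′ ε′) {ρ = ρ} facets d≡ p≡
    with δ≡suc⇒≡ k k′ (trans (p≡ (suc k′)) (cong (_+ ρ (suc k′)) (δ-refl k′)))
  ... | refl = cong (w k) (Finₚ.toℕ-injective (ℕₚ.+-cancelʳ-≡ 0 _ _ (trans (p≡ zero)
    (trans (cong (_+_ (toℕ ε′ + 0)) (vanishing-height facets (ℕₚ.suc-injective (sym d≡)) k ρk≡0))
      (ℕₚ.+-identityʳ (toℕ ε′ + 0))))))
    where
    ρk≡0 : ρ (suc k) ≡ 0
    ρk≡0 = ℕₚ.+-cancelˡ-≡ (δ k k) _ _ (trans (sym (p≡ (suc k))) (sym (ℕₚ.+-identityʳ (δ k k))))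
  indecomposable (w k ε) (q ε′) {ρ = ρ} facets d≡ p≡ = contradiction (ℕₚ.≤-trans r≤ε (ε≤1 ε)) (ℕₚ.<⇒≱ 2≤r)
    where
    r≤ε : r ≤ toℕ ε
    r≤ε = subst (r ≤_) (trans (sym (p≡ zero)) (ℕₚ.+-identityʳ (toℕ ε)))
      (ℕₚ.≤-trans (ℕₚ.m≤n+m r (toℕ ε′)) (ℕₚ.m≤m+n (toℕ ε′ + r) (ρ zero)))
  indecomposable (w k ε) (col y) {ρ = ρ} facets d≡ p≡ = contradiction e≤1 (ℕₚ.<⇒≱ (s≤s (ℕₚ.<⇒≤ 2≤D)))
    where
    e≤1 : e ≤ 1
    e≤1 = subst₂ _≤_ (Σp-Y (height y)) (∑ℕ-δ₁ k)
      (∑ℕ-mono (λ j → subst (1 ≤_) (sym (p≡ (suc j))) (s≤s z≤n)))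
  indecomposable (q ε) (w k′ ε′) {ρ = ρ} facets d≡ p≡ =
    contradiction (trans (p≡ (suc k′)) (cong (_+ ρ (suc k′)) (δ-refl k′))) λ ()
  indecomposable (q ε) (q ε′) {ρ = ρ} facets d≡ p≡ = cong (λ ε → q ε)
    (Finₚ.toℕ-injective (ℕₚ.+-cancelʳ-≡ r _ _ (trans (p≡ zero)
      (trans (cong (_+_ (toℕ ε′ + r)) (vanishing-height facets (ℕₚ.suc-injective (sym d≡)) zero (sym (p≡ (suc zero)))))
        (ℕₚ.+-identityʳ (toℕ ε′ + r))))))
  indecomposable (q ε) (col y) facets d≡ p≡ = contradiction (p≡ (suc zero)) λ ()
  -- The decisive case. The remainder has p-sum `D` and a vanishing coordinate, so `side` forces
  -- level `D`, where the only column is the hole. But `upper` allows the remainder height at most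
  -- `D`, so with `w_k` the height is at most `e`, one short of the hole.
  indecomposable (col y) (w k′ ε′) {k} {ρ} facets d≡ p≡ =
    contradiction (ℕₚ.≤-trans (ℕₚ.≤-reflexive (sym (top-height y level≡D))) height≤e) (ℕₚ.<⇒≱ ℕₚ.≤-refl)
    where
    level≡k : level y ≡ k
    level≡k = ℕₚ.suc-injective d≡
    ρk′≡0 : ρ (suc k′) ≡ 0
    ρk′≡0 = sym (ℕₚ.suc-injective (trans (p≡ (suc k′)) (cong (_+ ρ (suc k′)) (δ-refl k′))))
    Σρ≡D : Σp ρ ≡ D
    Σρ≡D = ℕₚ.suc-injective (trans (cong (_+ Σp ρ) (sym (∑ℕ-δ₁ k′))) (trans (sym (∑ℕ-+ (δ k′) (λ j → ρ (suc j))))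
      (trans (∑ℕ-cong (λ j → sym (p≡ (suc j)))) (Σp-Y (height y)))))
    D≤k : D ≤ k
    D≤k = subst₂ _≤_ Σρ≡D
      (trans (cong (λ x → k + D * x) ρk′≡0) (trans (cong (_+_ k) (ℕₚ.*-zeroʳ D)) (ℕₚ.+-identityʳ k)))
      (Facets.side facets k′)
    level≡D : level y ≡ D
    level≡D = ℕₚ.≤-antisym (level≤D y) (subst (D ≤_) (sym level≡k) D≤k)
    k≡D : k ≡ D
    k≡D = trans (sym level≡k) level≡D
    open ℕₚ.≤-Reasoning
    ρ₀≤D : ρ zero ≤ D
    ρ₀≤D = ℕₚ.+-cancelʳ-≤ (r * D) _ _ (begin
      ρ zero + r * D                   ≡⟨ cong (λ s → ρ zero + r * s) (sym Σρ≡D) ⟩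
      ρ zero + r * Σp ρ                ≤⟨ Facets.upper facets k′ ⟩
      r * k + r * (D * ρ (suc k′)) + k ≡⟨ cong₂ (λ k x → r * k + r * (D * x) + k) k≡D ρk′≡0 ⟩
      r * D + r * (D * 0) + D          ≡⟨ lem r D ⟩
      D + r * D                        ∎)
      where
      lem : ∀ r D → r * D + r * (D * 0) + D ≡ D + r * D
      lem = solve-∀
    height≤e : height y ≤ e
    height≤e = begin
      height y                ≡⟨ p≡ zero ⟩
      toℕ ε′ + 0 + ρ zero     ≤⟨ ℕₚ.+-mono-≤ (ℕₚ.≤-trans (ℕₚ.≤-reflexive (ℕₚ.+-identityʳ (toℕ ε′))) (ε≤1 ε′)) ρ₀≤D ⟩
      1 + D                   ∎
  indecomposable (col y) (q ε′) {ρ = ρ} facets d≡ p≡ = contradiction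
    (subst (r ≤_) (sym (p≡ zero)) (ℕₚ.≤-trans (ℕₚ.m≤n+m r (toℕ ε′)) (ℕₚ.m≤m+n (toℕ ε′ + r) (ρ zero))))
    (ℕₚ.<⇒≱ (height<r y))
  indecomposable (col y) (col y′) {k} {ρ} facets d≡ p≡ = cong (λ y → col y)
    (column-injective y y′
      (trans (ℕₚ.suc-injective d≡) (trans (cong (_+_ (level y′)) k≡0) (ℕₚ.+-identityʳ (level y′))))
      (trans (p≡ zero) (trans (cong (_+_ (height y′)) (vanishing-height facets k≡0 zero (ρ≡0 zero)))
        (ℕₚ.+-identityʳ (height y′)))))
    where
    ρ≡0 : ∀ j → ρ (suc j) ≡ 0
    ρ≡0 j = sym (ℕₚ.suc-injective (p≡ (suc j)))
    open ℕₚ.≤-Reasoning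
    -- The remainder lies over a multiple of q, so every unit of its degree costs height `r`, more
    -- than any column has.
    rk<r : r * k < r * 1
    rk<r = begin-strict
      r * k                     ≤⟨ Facets.lower facets ⟩
      ρ zero + r * Σp ρ         ≡⟨ cong (λ s → ρ zero + r * s) (trans (∑ℕ-const {e} 0 ρ≡0) (ℕₚ.*-zeroʳ e)) ⟩
      ρ zero + r * 0            ≡⟨ trans (cong (_+_ (ρ zero)) (ℕₚ.*-zeroʳ r)) (ℕₚ.+-identityʳ (ρ zero)) ⟩
      ρ zero                    ≤⟨ ℕₚ.m≤n+m (ρ zero) (height y′) ⟩
      height y′ + ρ zero        ≡⟨ sym (p≡ zero) ⟩
      height y                  <⟨ height<r y ⟩
      r                         ≡⟨ sym (ℕₚ.*-identityʳ r) ⟩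
      r * 1                     ∎
    k≡0 : k ≡ 0
    k≡0 = ℕₚ.n<1⇒n≡0 (ℕₚ.*-cancelˡ-< r k 1 rk<r)

  -- The degree becomes coordinate zero, so that sums of generators of different degrees are
  -- instances of `Units`.
  homogenize : ℕ → ℕPoint (suc e) → ℕPoint (2 + e)
  homogenize k α zero    = k
  homogenize k α (suc j) = α j

  G : Generator → ℕPoint (2 + e)
  G g = homogenize (deg g) (pt g)

  one-generator : ∀ {s k α β t} g → Units G s (homogenize t β) → k ≡ deg g + t →
    (∀ j → α j ≡ pt g j + β j) → Units G (suc s) (homogenize k α)
  one-generator g u k≡ α≡ = one g u λ { zero → k≡ ; (suc j) → α≡ j }

  vertices⇒generators : ∀ {t α} → Units V t α → Units G t (homogenize t α)
  vertices⇒generators (none α≗0) = none λ { zero → refl ; (suc j) → α≗0 j }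
  vertices⇒generators (one {t} {β = β} v u eq) = one-generator {β = β} g (vertices⇒generators u)
    (cong (_+ t) (sym deg≡1)) (λ j → trans (eq j) (cong (_+ β j) (sym (pt≡ j))))
    where
    found = vertex-generator (proj₁ (remQuot {2 + e} 2 v)) (proj₂ (remQuot {2 + e} 2 v))
    g = proj₁ found
    deg≡1 = proj₁ (proj₂ found)
    pt≡ = proj₂ (proj₂ found)

  generated : ∀ {k α} → Decomposition k α → ∃ λ s → Units G s (homogenize k α)
  generated (units u) = _ , vertices⇒generators u
  generated (core i z u k≡ α≡) =
    _ , one-generator (col (inj₂ (inj₁ (i , z)))) (vertices⇒generators u) k≡ α≡
  generated (hole k≡ α≡) = _ , one-generator {β = λ _ → 0} {t = 0} (col (inj₂ (inj₂ zero)))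
    (none λ { zero → refl ; (suc j) → refl })
    (trans k≡ (sym (ℕₚ.+-identityʳ e))) (λ j → trans (α≡ j) (sym (ℕₚ.+-identityʳ (Y (suc e) j))))

  module Basis {h} (enumeration : Fin h ↔ Generator) where

    generator : Fin h → Generator
    generator = Inverse.to enumeration

    number : Generator → Fin h
    number = Inverse.from enumeration

    generator-number : ∀ g → generator (number g) ≡ g
    generator-number = Inverse.strictlyInverseˡ enumeration

    generator-injective : ∀ {i i′} → generator i ≡ generator i′ → i ≡ i′
    generator-injective {i} {i′} eq = trans (sym (Inverse.strictlyInverseʳ enumeration i))
      (trans (cong number eq) (Inverse.strictlyInverseʳ enumeration i′))

    basis : Fin h → ConePt (suc e)
    basis i = (λ j → + pt (generator i) j) , + deg (generator i)

    Units⇒Facets : ∀ {s x} → Units (G ∘ generator) s x → Facets (x zero) (λ j → x (suc j))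
    Units⇒Facets u = Dilate⇒Facets (dilation u)
      where
      dilation : ∀ {s x} → Units (G ∘ generator) s x → Dilate V (x zero) (λ j → x (suc j))
      dilation (none x≗0) = Dilate-resp (sym (x≗0 zero)) (λ j → sym (x≗0 (suc j))) Dilate-zero
      dilation (one v u eq) = Dilate-resp (sym (eq zero)) (λ j → sym (eq (suc j)))
        (Dilate-+ (pt∈ (generator v)) (dilation u))

    Units-number : ∀ {s x} → Units G s x → Units (G ∘ generator) s x
    Units-number (none x≗0) = none x≗0
    Units-number (one {β = β} g u eq) = one (number g) (Units-number u)
      (λ j → trans (eq j) (cong (λ g → G g j + β j) (sym (generator-number g))))

    Units⇒GeneratedBy : ∀ {s k α′ x} → (∀ j → proj₁ x j ≡ + α′ j) → proj₂ x ≡ + k →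
      Units (G ∘ generator) s (homogenize k α′) → GeneratedBy basis (λ _ → true) x
    Units⇒GeneratedBy α≡ t≡ u = c , (λ _ ()) ,
      (λ j → trans (α≡ j) (trans (cong +_ (x≡ (suc j))) (sym (∑-pos-* c (λ i → pt (generator i) j))))) ,
      trans t≡ (trans (cong +_ (x≡ zero)) (sym (∑-pos-* c (λ i → deg (generator i)))))
      where
      c = proj₁ (Units-weights u)
      x≡ = proj₂ (Units-weights u)

    Dilate⇒GeneratedBy : ∀ {k α′ x} → (∀ j → proj₁ x j ≡ + α′ j) → proj₂ x ≡ + k →
      Dilate V k α′ → GeneratedBy basis (λ _ → true) x
    Dilate⇒GeneratedBy α≡ t≡ α′∈ =
      Units⇒GeneratedBy α≡ t≡ (Units-number (proj₂ (generated (Facets⇒Decomposition (Dilate⇒Facets α′∈)))))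

    basis-generates : Generates (embed V) basis (λ _ → true)
    basis-generates x x∈C = from (InCone⇒Dilate x∈C)
      where
      from : _ → GeneratedBy basis (λ _ → true) x
      from (α′ , k , α≡ , t≡ , α′∈) = Dilate⇒GeneratedBy α≡ t≡ α′∈

    -- Degrees of generators are positive, so some generator `l` occurs in the expansion. Taking one
    -- copy away leaves a sum of generators, which satisfies the facet inequalities, and
    -- indecomposability gives `l ≡ i`; but `i` was excluded by `S`.
    irredundant : ∀ {S i} → S i ≡ false → ¬ GeneratedBy basis S (basis i)
    irredundant {i = i} Si≡false (a , a-supp , pt≡ , deg≡) =
      contradiction (trans (sym (a-supp i Si≡false)) (subst (λ l → a l ≡ suc x) l≡i al≡)) λ ()
      where
      expansion : ∀ j → G (generator i) j ≡ ∑ℕ (λ l → a l * G (generator l) j)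
      expansion zero    = ℤₚ.+-injective (trans deg≡ (∑-pos-* a (λ l → deg (generator l))))
      expansion (suc j) = ℤₚ.+-injective (trans (pt≡ j) (∑-pos-* a (λ l → pt (generator l) j)))
      used : ∃₂ λ l x → a l ≡ suc x
      used with ∑ℕ-nonzero-term (λ l → a l * deg (generator l))
                  (trans (sym (expansion zero)) (proj₂ (deg≡suc (generator i))))
      ... | l , y , ≡suc with a l in al≡
      ...   | suc x = l , x , al≡
      l = proj₁ used
      x = proj₁ (proj₂ used)
      al≡ : a l ≡ suc x
      al≡ = proj₂ (proj₂ used)
      rest : Fin h → ℕ
      rest m = a m ∸ δ l m
      l≡i : l ≡ i
      l≡i = sym (generator-injective (indecomposable (generator i) (generator l)
        (Units⇒Facets (Units-combination (λ m → m) rest))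
        (trans (expansion zero) (∑ℕ-δ+rest a (λ m → deg (generator m)) l al≡))
        (λ j → trans (expansion (suc j)) (∑ℕ-δ+rest a (λ m → pt (generator m) j) l al≡))))

    basis-minimal : ∀ S → Generates (embed V) basis S → ∀ i → S i ≡ true
    basis-minimal S generates i with S i in Si≡
    ... | true  = refl
    ... | false = ⊥-elim (irredundant Si≡ (generates (basis i) (Dilate⇒InCone (pt∈ (generator i)))))

    μHilb : MuHilb (embed V) e
    μHilb = h , basis ,
      ((λ i → Dilate⇒InCone (pt∈ (generator i))) , basis-generates , basis-minimal) ,
      (number top , cong (λ g → + deg g) (generator-number top)) ,
      (λ i → ℤ.+≤+ (deg≤e (generator i)))
      where
      top : Generator
      top = col (inj₂ (inj₂ zero))

  enumeration : Fin (e * 2 + (2 + (2 + ((D ∸ 1) * r + 1)))) ↔ Generator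
  enumeration = ↔-trans Finₚ.+↔⊎ (Finₚ.*↔× ⊎-↔ ↔-trans Finₚ.+↔⊎ (↔-refl ⊎-↔
    ↔-trans Finₚ.+↔⊎ (↔-refl ⊎-↔ ↔-trans Finₚ.+↔⊎ (Finₚ.*↔× ⊎-↔ ↔-refl))))

  polytope : Σ ℕ λ N → Σ ℕ λ n → Σ (Polytope N n) λ P →
    Dim P (suc e) × MuHilb P e × MuMidp P D × MuIdp P D
  polytope = suc e , (2 + e) * 2 , embed V , V-dim , Basis.μHilb enumeration ,
    (1≤D , IDP-from-D D ℕₚ.≤-refl , ¬IDP-below-D) ,
    (1≤D , IDP-from-D , λ k 1≤k k<D idp-from-k → ¬IDP-below-D k 1≤k k<D (idp-from-k k ℕₚ.≤-refl))
    where
    1≤D : 1 ≤ D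
    1≤D = ℕₚ.<⇒≤ 2≤D

theorem2p6 : (d : ℕ) → 4 ≤ d →
    Σ ℕ λ N → Σ ℕ λ n → Σ (Polytope N n) λ P →
    Dim P d × MuHilb P (d ∸ 1) × MuMidp P (d ∸ 2) × MuIdp P (d ∸ 2)
-- Only here is `r` replaced by its value; inside the construction it is a variable, so that
-- products with `r` stay unreduced.
theorem2p6 (suc (suc D)) (s≤s (s≤s 2≤D)) = Construction.polytope D 2≤D (3 + D) refl
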